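{- Let $s$ and $d$ be relatively prime positive integers. The number of self-conjugate $(s,s+d,s+2d,s+3d)$-core partitions is \[ \sum_{i=0}^{\lfloor s/4\rfloor}\binom{\frac{s+d-1}{2}-i}{\frac{s-1}{2}-2i} \binom{\frac{s+d-1}{2}-i}{i}\qquad\text{if $d$ is even,} \] and \[ \sum_{i=0}^{\lfloor s/2 \rfloor}\binom{\lfloor \frac{s+d-1}{2}\rfloor-\lfloor \frac{i}{2} \rfloor}{\lfloor \frac{s}{2} \rfloor-i}\binom{\lfloor \frac{s+d}{2} \rfloor-\lfloor \frac{i+1}{2} \rfloor}{\lfloor \frac{i}{2} \rfloor}\qquad\text{if $d$ is odd.} \]
   Context: A partition is a finite (possibly empty) non-increasing sequence of positive integers, identified with its Young diagram. The hook length of a box is the number of boxes to its right in the same row plus the number of boxes below it in the same column plus $1$. A partition is an $s$-core if no box has hook length $s$, and an $(s_1,\dots,s_q)$-core if it is an $s_i$-core for every $i$. A partition is self-conjugate if its Young diagram is invariant under reflection in the main diagonal. -}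

module Defs where

open import Data.Nat.Base using (ℕ; zero; suc; _+_; _∸_; _<_; _≥_)
open import Data.Nat.Properties using (_<?_)
open import Data.List.Base using (List; []; _∷_; length; filter; drop; map; upTo; sum)
open import Data.List.Membership.Propositional using (_∈_)
open import Data.List.Relation.Unary.All using (All)
open import Data.List.Relation.Unary.Linked using (Linked)
open import Data.List.Relation.Unary.Unique.Propositional using (Unique)
open import Data.Product.Base using (_×_; ∃-syntax)
open import Function.Bundles using (_⇔_)
open import Relation.Binary.PropositionalEquality using (_≡_; _≢_)

record Partition : Set where
  constructor mkPartition
  field
    parts         : List ℕ
    nonincreasing : Linked _≥_ parts
    positive      : All (0 <_) parts

open Partition public

-- Rows past the last part have length 0.
rowLength : List ℕ → ℕ → ℕ
rowLength []       _       = 0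
rowLength (x ∷ _)  zero    = x
rowLength (_ ∷ xs) (suc i) = rowLength xs i

-- Rows and columns of the Young diagram are numbered from 0, so row i
-- consists of the boxes (i , j) with 0 ≤ j < rowLength i.
Box : Partition → ℕ → ℕ → Set
Box p i j = j < rowLength (parts p) i

-- The boxes (i , j′) with j < j′.
arm : Partition → ℕ → ℕ → ℕ
arm p i j = rowLength (parts p) i ∸ suc j

-- Each row below row i contributes a box to column j exactly when it is
-- longer than j.
leg : Partition → ℕ → ℕ → ℕ
leg p i j = length (filter (j <?_) (drop (suc i) (parts p)))

-- Meaningful only when (i , j) is a box of p.
hookLength : Partition → ℕ → ℕ → ℕ
hookLength p i j = arm p i j + leg p i j + 1

IsCore : ℕ → Partition → Set
IsCore s p = ∀ i j → Box p i j → hookLength p i j ≢ s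

IsSimultaneousCore : List ℕ → Partition → Set
IsSimultaneousCore ss p = All (λ s → IsCore s p) ss

SelfConjugate : Partition → Set
SelfConjugate p = ∀ i j → Box p i j ⇔ Box p j i

-- Exactly n elements of A satisfy P.  Counting through a duplicate-free
-- list of elements, rather than a bijection between Fin n and the type
-- ∃ P, avoids counting an element once for each proof of P.
HasCount : {A : Set} → (A → Set) → ℕ → Set
HasCount {A} P n =
  ∃[ xs ] Unique xs × (∀ (x : A) → x ∈ xs ⇔ P x) × length xs ≡ n

∑[0⋯_] : ℕ → (ℕ → ℕ) → ℕ
∑[0⋯ n ] f = sum (map f (upTo (suc n)))

{-# OPTIONS --safe #-}
module Submission where

-- With bᵢ = λᵢ - i, the hook of a self-conjugate partition λ at the box (i , j) has length
-- bᵢ + bⱼ - 1, and the set T of all bᵢ contains exactly one of x and 1 - x.  Hence λ is an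
-- s-core iff T is closed under subtracting s.  Write x = j d + i s + c.  Then T is given by the
-- maximal heights i = h(j) of its elements in the columns j; h is quasiperiodic and has a point
-- symmetry, and closure under subtracting s + k d means h(j + k) ≤ h(j) + 1.  For the letters
-- a(j) = h(j) - h(j + 1) + 1 the conditions with k = 1, 2, 3 say that a ≥ 0 and that neither
-- 0 0 nor 0 1 0 occurs.  The symmetry makes the sequence a palindromic, so that it is determined
-- by half a period, which ends in a central letter of known parity.  The generating function of
-- such words is 1 / (1 - z (1 + y) (1 + z y²)) up to boundary terms, and the coefficients of the
-- powers of z (1 + y) (1 + z y²) are products of two binomial coefficients.

open import Defs
open import Data.Nat.Base as ℕ using (ℕ; zero; suc; NonZero; s≤s; z≤n; z<s)
import Data.Nat.Properties as ℕ
open import Data.Nat.Coprimality using (Coprime; coprime-Bézout)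
open import Data.Nat.Induction using (<-rec)
open import Data.Empty using (⊥-elim)
open import Data.Unit.Base using (⊤; tt)
open import Data.List.Base using (List; _∷_; []; length; filter; drop; applyUpTo; upTo; map; _++_)
import Data.List.Properties as List
open import Data.List.Membership.Propositional using (_∈_)
import Data.List.Membership.Propositional.Properties as ∈
open import Data.List.Relation.Unary.All using (All; []; _∷_)
import Data.List.Relation.Unary.All as All
import Data.List.Relation.Unary.All.Properties as All
open import Data.List.Relation.Unary.AllPairs using ([]; _∷_)
open import Data.List.Relation.Unary.Any using (here; there)
open import Data.List.Relation.Unary.Linked using (Linked; []; [-]; _∷_)
import Data.List.Relation.Unary.Linked as Linked
import Data.List.Relation.Unary.Linked.Properties as Linked
open import Data.List.Relation.Unary.Unique.Propositional using (Unique)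
import Data.List.Relation.Unary.Unique.Propositional.Properties as Unique
open import Data.Product.Base using (_×_; _,_; proj₁; proj₂; ∃-syntax)
open import Data.Sum.Base using (_⊎_; inj₁; inj₂)
open import Function.Base using (_∘_; id)
open import Function.Bundles using (_⇔_; mk⇔; Equivalence)
open Equivalence using (to; from)
open import Relation.Binary.PropositionalEquality
open import Relation.Nullary.Decidable.Core using (Dec; yes; no)
open import Relation.Nullary.Negation.Core using (¬_)

-- Over a period the letters add up to s + d; a word has about half of this to spend, and the
-- boundary decides the exact budget `M`. On letters the two reflections are j ↦ α - 1 - j and j ↦ 2
-- μ - j, and each of them fixes either a letter or a gap between two letters. The coordinates are
-- normalised so that the right-hand centre is always a letter; its parity is that of d + β. For odd
-- s the left-hand centre is a gap. The two equal letters around it must not both be 0, which is the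
-- state `nonzero`. For even s, where d is odd, the left-hand centre is a letter too. It is even,
-- and half of it becomes an additional first letter of a word in the state `free`. So odd d leads
-- to two kinds of words with different counts, and it is the floors in the second formula that
-- cover both.

module _ where

  -- Counting through duplicate-free lists

  private variable
    A B : Set
    P Q : A → Set
    m n : ℕ

  hasCount-cong : (∀ x → P x ⇔ Q x) → HasCount P n → HasCount Q n
  hasCount-cong P⇔Q (xs , unique , ∈⇔P , len) =
    xs , unique , (λ x → mk⇔ (to (P⇔Q x) ∘ to (∈⇔P x)) (from (∈⇔P x) ∘ from (P⇔Q x))) , len

  hasCount-∅ : (∀ (x : A) → ¬ P x) → HasCount P 0
  hasCount-∅ ¬P = [] , [] , (λ x → mk⇔ (λ ()) (λ p → ⊥-elim (¬P x p))) , refl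

  hasCount-single : (a : A) → (∀ x → x ≡ a ⇔ P x) → HasCount P 1
  hasCount-single a ≡⇔P = a ∷ [] , [] ∷ [] ,
    (λ x → mk⇔ (λ { (here e) → to (≡⇔P x) e ; (there ()) }) (here ∘ from (≡⇔P x))) , refl

  hasCount-⊎ : (∀ x → P x → ¬ Q x) → HasCount P m → HasCount Q n → HasCount (λ x → P x ⊎ Q x) (m ℕ.+ n)
  hasCount-⊎ {P = P} {Q = Q} disjoint (xs , uxs , xs⇔ , refl) (ys , uys , ys⇔ , refl) =
    xs ++ ys ,
    Unique.++⁺ uxs uys (λ { (∈xs , ∈ys) → disjoint _ (to (xs⇔ _) ∈xs) (to (ys⇔ _) ∈ys) }) ,
    (λ x → mk⇔ (split x) (λ { (inj₁ p) → ∈.∈-++⁺ˡ (from (xs⇔ x) p) ; (inj₂ q) → ∈.∈-++⁺ʳ xs (from (ys⇔ x) q) })) ,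
    List.length-++ xs
    where
    split : ∀ x → x ∈ xs ++ ys → P x ⊎ Q x
    split x x∈ with ∈.∈-++⁻ xs x∈
    ... | inj₁ i = inj₁ (to (xs⇔ x) i)
    ... | inj₂ i = inj₂ (to (ys⇔ x) i)

  unique-map : (f : B → A) → (∀ {b b′} → Q b → Q b′ → f b ≡ f b′ → b ≡ b′) →
    ∀ {bs} → All Q bs → Unique bs → Unique (map f bs)
  unique-map f inj []       []       = []
  unique-map f inj (q ∷ qs) (b∉ ∷ u) =
    All.map⁺ (All.zipWith (λ { (q′ , b≢) e → b≢ (inj q q′ e) }) (qs , b∉)) ∷ unique-map f inj qs u

  -- Injectivity is asked for on `Q` only: that distinct letter lists give distinct partitions is
  -- derived from their being words.
  hasCount-map : (f : B → A) → (∀ {b b′} → Q b → Q b′ → f b ≡ f b′ → b ≡ b′) →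
    (∀ a → P a ⇔ (∃[ b ] Q b × a ≡ f b)) → HasCount Q n → HasCount P n
  hasCount-map {Q = Q} {P = P} f inj P⇔ (bs , unique , ∈⇔Q , len) =
    map f bs , unique-map f inj (All.tabulate (to (∈⇔Q _))) unique , (λ a → mk⇔ (image a) (preimage a)) ,
    trans (List.length-map f bs) len
    where
    image : ∀ a → a ∈ map f bs → P a
    image a a∈ with ∈.∈-map⁻ f a∈
    ... | b , b∈ , e = from (P⇔ a) (b , to (∈⇔Q b) b∈ , e)
    preimage : ∀ a → P a → a ∈ map f bs
    preimage a p with to (P⇔ a) p
    ... | b , q , refl = ∈.∈-map⁺ f (from (∈⇔Q b) q)

-- Half-words avoiding 0 0 and 0 1 0

data State : Set where
  free blocked nonzero : State

-- Word ε σ k M l: the k letters l have sum at most M; followed by the central letter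
-- 2 b + ε, where b is what remains of M, and by the mirror image of l, they contain neither
-- 0 0 nor 0 1 0.  A word that starts in the state blocked is preceded by a 0; one that starts
-- in the state nonzero is preceded by 0 1 or, equivalently, by its own mirror image.
data Word (ε : ℕ) : State → ℕ → ℕ → List ℕ → Set where
  end-free     : ∀ {M} → Word ε free 0 M []
  end-blocked  : ∀ {M} → 2 ℕ.≤ M ℕ.+ M ℕ.+ ε → Word ε blocked 0 M []
  end-nonzero : ∀ {M} → 1 ℕ.≤ M ℕ.+ M ℕ.+ ε → Word ε nonzero 0 M []
  free-zero    : ∀ {k M l} → Word ε blocked k M l → Word ε free (suc k) M (0 ∷ l)
  free-suc     : ∀ {k M l} → Word ε nonzero (suc k) M l → Word ε free (suc k) M l
  blocked-one  : ∀ {k M l} → Word ε nonzero k M l → Word ε blocked (suc k) (suc M) (1 ∷ l)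
  blocked-suc  : ∀ {k M a l} → Word ε nonzero (suc k) M (a ∷ l) → Word ε blocked (suc k) (suc M) (suc a ∷ l)
  nonzero-one : ∀ {k M l} → Word ε free k M l → Word ε nonzero (suc k) (suc M) (1 ∷ l)
  nonzero-suc : ∀ {k M a l} → Word ε nonzero (suc k) M (a ∷ l) → Word ε nonzero (suc k) (suc M) (suc a ∷ l)

<-ext : ∀ {m n} → (∀ i → i ℕ.< m ⇔ i ℕ.< n) → m ≡ n
<-ext {m} {n} e = ℕ.≤-antisym
  (ℕ.≮⇒≥ λ n<m → ℕ.<-irrefl refl (to (e n) n<m))
  (ℕ.≮⇒≥ λ m<n → ℕ.<-irrefl refl (from (e m) m<n))

-- Hooks and beads of self-conjugate partitions

rowLength-suc-≤ : ∀ {xs} → Linked ℕ._≥_ xs → ∀ i → rowLength xs (suc i) ℕ.≤ rowLength xs i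
rowLength-suc-≤ []      i       = z≤n
rowLength-suc-≤ [-]     i       = z≤n
rowLength-suc-≤ (r ∷ l) zero    = r
rowLength-suc-≤ (r ∷ l) (suc i) = rowLength-suc-≤ l i

rowLength-antitone : ∀ {xs} → Linked ℕ._≥_ xs → ∀ {i k} → i ℕ.≤ k → rowLength xs k ℕ.≤ rowLength xs i
rowLength-antitone {xs} l i≤k = go (ℕ.≤⇒≤′ i≤k)
  where
  go : ∀ {i k} → i ℕ.≤′ k → rowLength xs k ℕ.≤ rowLength xs i
  go ℕ.≤′-refl     = ℕ.≤-refl
  go (ℕ.≤′-step q) = ℕ.≤-trans (rowLength-suc-≤ l _) (go q)

rowLength-≤-head : ∀ {xs} → Linked ℕ._≥_ xs → ∀ i → rowLength xs i ℕ.≤ rowLength xs 0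
rowLength-≤-head l i = rowLength-antitone l {0} z≤n

-- In a non-increasing sequence the parts longer than `j` form an initial segment, so their number
-- is the length of column `j`.
columnLength : ∀ {xs} → Linked ℕ._≥_ xs → ∀ i j →
  i ℕ.< length (filter (j ℕ.<?_) xs) ⇔ j ℕ.< rowLength xs i
columnLength {[]} _ i j = mk⇔ (λ ()) (λ ())
columnLength {x ∷ xs} l i j with j ℕ.<? x
... | yes j<x rewrite List.filter-accept (j ℕ.<?_) {x} {xs} j<x with i
...   | zero  = mk⇔ (λ _ → j<x) (λ _ → z<s)
...   | suc k = mk⇔ (λ { (s≤s q) → to (columnLength (Linked.tail l) k j) q })
                    (λ q → s≤s (from (columnLength (Linked.tail l) k j) q))
columnLength {x ∷ xs} l i j | no j≮x rewrite List.filter-reject (j ℕ.<?_) {x} {xs} j≮x = mk⇔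
  (λ q → ⊥-elim (j≮x (ℕ.<-≤-trans (to (columnLength (Linked.tail l) i j) q) (rowLength-≤-head l (suc i)))))
  (λ q → ⊥-elim (j≮x (ℕ.<-≤-trans q (rowLength-≤-head l i))))

rowLength-drop : ∀ xs n i → rowLength (drop n xs) i ≡ rowLength xs (n ℕ.+ i)
rowLength-drop xs       zero    i = refl
rowLength-drop []       (suc n) i = refl
rowLength-drop (x ∷ xs) (suc n) i = rowLength-drop xs n i

drop-Linked : ∀ {xs : List ℕ} n → Linked ℕ._≥_ xs → Linked ℕ._≥_ (drop n xs)
drop-Linked zero    l = l
drop-Linked {[]}     (suc n) l = []
drop-Linked {x ∷ xs} (suc n) l = drop-Linked n (Linked.tail l)

m+n<o⇒n<o∸m : ∀ m {n o} → m ℕ.+ n ℕ.< o → n ℕ.< o ℕ.∸ m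
m+n<o⇒n<o∸m m {n} {o} p = subst (ℕ._≤ o ℕ.∸ m) (ℕ.m+n∸m≡n m (suc n))
  (ℕ.∸-monoˡ-≤ m (subst (ℕ._≤ o) (sym (ℕ.+-suc m n)) p))

n<o∸m⇒m+n<o : ∀ m {n o} → n ℕ.< o ℕ.∸ m → m ℕ.+ n ℕ.< o
n<o∸m⇒m+n<o zero    p = p
n<o∸m⇒m+n<o (suc m) {o = suc o} p = s≤s (n<o∸m⇒m+n<o m p)

module _ (p : Partition) (sc : SelfConjugate p) where

  row : ℕ → ℕ
  row = rowLength (parts p)

  -- Column `j` is as long as row `j`. The leg thereby becomes a difference of the same form as the
  -- arm, with `i` and `j` exchanged.
  leg-selfConjugate : ∀ i j → leg p i j ≡ row j ℕ.∸ suc i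
  leg-selfConjugate i j = <-ext λ k → mk⇔
    (λ q → m+n<o⇒n<o∸m (suc i) (to (sc (suc i ℕ.+ k) j)
      (subst (j ℕ.<_) (rowLength-drop (parts p) (suc i) k) (to (columnLength lk k j) q))))
    (λ q → from (columnLength lk k j) (subst (j ℕ.<_) (sym (rowLength-drop (parts p) (suc i) k))
      (from (sc (suc i ℕ.+ k) j) (n<o∸m⇒m+n<o (suc i) q))))
    where
    lk : Linked ℕ._≥_ (drop (suc i) (parts p))
    lk = drop-Linked (suc i) (nonincreasing p)

module _ where
  open import Data.Integer.Base using (ℤ; +_; -[1+_]; ∣_∣; _+_; _*_; _-_; -_; _≤_; _<_; +≤+; -≤+; -≤-; +<+; 0ℤ; 1ℤ)
  open import Data.Integer.DivMod using (_/ℕ_; _%ℕ_; n%ℕd<d; a≡a%ℕn+[a/ℕn]*n)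
  import Data.Integer.Properties as ℤ
  open import Data.Integer.Solver using (module +-*-Solver)
  open import Data.Nat.GCD using (module Bézout)
  open +-*-Solver using (solve; con; _:+_; _:*_; _:-_; :-_; _:=_)

  -- Linear arithmetic by certificate: the hypothesis is a combination of known equations, and the
  -- ring solver confirms that both differences are the same polynomial. `≤-by` does this for
  -- inequalities.
  ≡-by : ∀ {a b x y} → a ≡ b → a - b ≡ x - y → x ≡ y
  ≡-by {a} {b} {x} {y} e p = ℤ.i-j≡0⇒i≡j x y (trans (sym p) (ℤ.i≡j⇒i-j≡0 {a} e))

  ≤-by : ∀ {a b x y} → a ≤ b → b - a ≡ y - x → x ≤ y
  ≤-by p e = ℤ.0≤i-j⇒j≤i (subst (0ℤ ≤_) e (ℤ.i≤j⇒0≤j-i p))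

  <⇒+1≤ : ∀ {x y} → x < y → x + + 1 ≤ y
  <⇒+1≤ {x} p = subst (_≤ _) (ℤ.+-comm (+ 1) x) (ℤ.i<j⇒suc[i]≤j p)

  +1≤⇒< : ∀ {x y} → x + + 1 ≤ y → x < y
  +1≤⇒< {x} p = ℤ.suc[i]≤j⇒i<j (subst (_≤ _) (ℤ.+-comm x (+ 1)) p)

  ≤-ext : ∀ {m n} → (∀ i → i ≤ m → i ≤ n) → (∀ i → i ≤ n → i ≤ m) → m ≡ n
  ≤-ext {m} {n} f g = ℤ.≤-antisym (f m ℤ.≤-refl) (g n ℤ.≤-refl)

  content : Partition → ℕ → ℤ
  content p i = + rowLength (parts p) i - + i

  -- The Maya diagram of p.
  Beads : Partition → ℤ → Set
  Beads p x = ∃[ i ] content p i ≡ x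

  module _ (p : Partition) (sc : SelfConjugate p) where

    private
      λ′ : ℕ → ℕ
      λ′ = rowLength (parts p)

    hook-content : ∀ i j → Box p i j → content p i + content p j ≡ + suc (hookLength p i j)
    hook-content i j b rewrite leg-selfConjugate p sc i j = begin
      (+ λ′ i - + i) + (+ λ′ j - + j)
        ≡⟨ cong₂ (λ u v → (+ u - + i) + (+ v - + j)) (sym (ℕ.m+[n∸m]≡n b)) (sym (ℕ.m+[n∸m]≡n (to (sc i j) b))) ⟩
      (+ (suc j ℕ.+ A) - + i) + (+ (suc i ℕ.+ L) - + j)
        ≡⟨ solve 4 (λ i j a l → ((con (+ 1) :+ j :+ a) :- i) :+ ((con (+ 1) :+ i :+ l) :- j)
             := con (+ 1) :+ (a :+ l :+ con (+ 1))) refl (+ i) (+ j) (+ A) (+ L) ⟩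
      + suc (A ℕ.+ L ℕ.+ 1) ∎
      where
      open ≡-Reasoning
      A = λ′ i ℕ.∸ suc j
      L = λ′ j ℕ.∸ suc i

    -- Together with `hook-content` this lets sums of two contents detect hook lengths without
    -- mention of boxes: a sum at least 1 can only come from a box.
    nonbox-content : ∀ i j → ¬ Box p i j → content p i + content p j ≤ 0ℤ
    nonbox-content i j nb = ≤-by
      (ℤ.+-mono-≤ (+≤+ (ℕ.≮⇒≥ nb)) (+≤+ (ℕ.≮⇒≥ (nb ∘ from (sc i j)))))
      (solve 4 (λ a b i j → (j :+ i) :- (a :+ b) := con 0ℤ :- ((a :- i) :+ (b :- j))) refl
         (+ λ′ i) (+ λ′ j) (+ i) (+ j))

    isCore⇒ : ∀ s → IsCore s p → ∀ i j → content p i + content p j ≢ + suc s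
    isCore⇒ s core i j e with j ℕ.<? λ′ i
    ... | yes b = core i j b (ℕ.suc-injective (ℤ.+-injective (trans (sym (hook-content i j b)) e)))
    ... | no nb with subst (_≤ 0ℤ) e (nonbox-content i j nb)
    ...   | +≤+ ()

    isCore⇐ : ∀ s → (∀ i j → content p i + content p j ≢ + suc s) → IsCore s p
    isCore⇐ s h i j b e = h i j (trans (hook-content i j b) (cong (λ k → + suc k) e))

  record Symmetric (T : ℤ → Set) : Set where
    field
      exclusive : ∀ {x y} → T x → T y → x + y ≢ 1ℤ
      covering  : ∀ x → T x ⊎ T (1ℤ - x)

  open Symmetric

  Closed : (ℤ → Set) → ℕ → Set
  Closed T s = ∀ {x} → T x → T (x - + s)

  module _ (p : Partition) (sc : SelfConjugate p) where

    private
      λ′ : ℕ → ℕ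
      λ′ = rowLength (parts p)

      Cov : ℕ → Set
      Cov n = Beads p (+ suc n) ⊎ Beads p (- + n)

      search : ∀ n i → λ′ i ℕ.≤ i ℕ.+ suc n →
        ∃[ k ] (λ′ k ℕ.≤ k ℕ.+ suc n × (∀ k′ → k ≡ suc k′ → k′ ℕ.+ suc n ℕ.< λ′ k′))
      search n zero    le = 0 , le , λ _ ()
      search n (suc i) le with λ′ i ℕ.≤? i ℕ.+ suc n
      ... | yes le′ = search n i le′
      ... | no  gt  = suc i , le , λ { _ refl → ℕ.≰⇒> gt }

      -- Let `k` be the first row with content at most n + 1. Unless equality holds, row `k` has
      -- length at most k + n, while all earlier rows are longer than k + n. Hence column k + n, and
      -- by symmetry row k + n, has length `k`, and the content of that row is -n.
      cov : ∀ n → Cov n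
      cov n with search n (λ′ 0) (ℕ.≤-trans (rowLength-≤-head (nonincreasing p) (λ′ 0)) (ℕ.m≤m+n _ _))
      ... | k , le , pre with λ′ k ℕ.≟ k ℕ.+ suc n
      ... | yes e = inj₁ (k , trans (cong (λ u → + u - + k) e)
                       (solve 2 (λ k n → (k :+ n) :- k := n) refl (+ k) (+ suc n)))
      ... | no ne = inj₂ (k ℕ.+ n , trans (cong (λ u → + u - + (k ℕ.+ n)) row≡)
                       (solve 2 (λ k n → k :- (k :+ n) := :- n) refl (+ k) (+ n)))
        where
        lt : λ′ k ℕ.≤ k ℕ.+ n
        lt = ℕ.≤-pred (subst (suc (λ′ k) ℕ.≤_) (ℕ.+-suc k n) (ℕ.≤∧≢⇒< le ne))
        ge : ∀ k → (∀ k′ → k ≡ suc k′ → k′ ℕ.+ suc n ℕ.< λ′ k′) → k ℕ.≤ λ′ (k ℕ.+ n)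
        ge zero    _ = z≤n
        ge (suc k) f = to (sc k (suc k ℕ.+ n)) (subst (ℕ._< λ′ k) (ℕ.+-suc k n) (f k refl))
        row≡ : λ′ (k ℕ.+ n) ≡ k
        row≡ = ℕ.≤-antisym (ℕ.≮⇒≥ λ q → ℕ.≤⇒≯ lt (from (sc k (k ℕ.+ n)) q)) (ge k pre)

    -- A sum of 1 would be a hook of length 0 inside the diagram, and outside the sum is at most 0.
    -- This gives exclusiveness.
    beads-symmetric : Symmetric (Beads p)
    beads-symmetric .exclusive (i , refl) (j , refl) e with j ℕ.<? λ′ i
    ... | yes b = ℕ.1+n≢0 (trans (sym (ℕ.+-comm _ 1))
                    (ℕ.suc-injective (ℤ.+-injective (trans (sym (hook-content p sc i j b)) e))))
    ... | no nb with subst (_≤ 0ℤ) e (nonbox-content p sc i j nb)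
    ...   | +≤+ ()
    beads-symmetric .covering (+ zero) with cov 0
    ... | inj₁ b = inj₂ b
    ... | inj₂ b = inj₁ b
    beads-symmetric .covering (+ suc n) with cov n
    ... | inj₁ b = inj₁ b
    ... | inj₂ b = inj₂ (subst (Beads p) (solve 1 (λ n → :- n := con 1ℤ :- (con 1ℤ :+ n)) refl (+ n)) b)
    beads-symmetric .covering -[1+ n ] with cov (suc n)
    ... | inj₁ b = inj₂ b
    ... | inj₂ b = inj₁ b

    beads-bounded : ∀ {x} → Beads p x → x ≤ + λ′ 0
    beads-bounded (i , refl) = ℤ.≤-trans (ℤ.i-j≤i (+ λ′ i) (+ i)) (+≤+ (rowLength-≤-head (nonincreasing p) i))

    -- If x - s were missing, its mirror image 1 - x + s would be a bead. Together with x it has sum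
    -- s + 1, which is a hook of length s.
    isCore⇒closed : ∀ s → IsCore s p → Closed (Beads p) s
    isCore⇒closed s core {x} (i , refl) with covering beads-symmetric (x - + s)
    ... | inj₁ b = b
    ... | inj₂ (j , e) = ⊥-elim (isCore⇒ p sc s core i j (trans (cong (λ y → x + y) e)
        (solve 2 (λ x s → x :+ (con 1ℤ :- (x :- s)) := con 1ℤ :+ s) refl x (+ s))))

    closed⇒isCore : ∀ s → Closed (Beads p) s → IsCore s p
    closed⇒isCore s cl = isCore⇐ p sc s λ i j e →
      exclusive beads-symmetric (cl (i , refl)) (j , refl)
        (≡-by e (solve 3 (λ x y s → (x :+ y) :- (con 1ℤ :+ s) := (x :- s :+ y) :- con 1ℤ) refl
          (content p i) (content p j) (+ s)))

  -- The contents are strictly decreasing, so the i-th one is the i-th largest bead.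
  content-strict : ∀ p {i j} → i ℕ.< j → content p j < content p i
  content-strict p {i} {j} i<j = ℤ.+-mono-≤-<
    (+≤+ (rowLength-antitone (nonincreasing p) (ℕ.<⇒≤ i<j))) (ℤ.neg-mono-< (+<+ i<j))

  -- The i-th bead of `p` is the j-th bead of `q` for some j. Here j < i is impossible, since the
  -- earlier beads agree and the contents of `p` decrease strictly.
  content-≤ : ∀ p q → (∀ {x} → Beads p x → Beads q x) → ∀ i →
    (∀ {k} → k ℕ.< i → content p k ≡ content q k) → content p i ≤ content q i
  content-≤ p q sub i ih with sub (i , refl)
  ... | j , e with j ℕ.<? i
  ... | yes j<i = ⊥-elim (ℤ.<-irrefl (trans (sym e) (sym (ih j<i))) (content-strict p j<i))
  ... | no j≮i with ℕ.m≤n⇒m<n∨m≡n (ℕ.≮⇒≥ j≮i)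
  ...   | inj₂ refl = ℤ.≤-reflexive (sym e)
  ...   | inj₁ i<j  = subst (_≤ content q i) e (ℤ.<⇒≤ (content-strict q i<j))

  content-determined : ∀ p q → (∀ {x} → Beads p x ⇔ Beads q x) → ∀ i → content p i ≡ content q i
  content-determined p q eqv = <-rec _ λ i ih → ℤ.≤-antisym
    (content-≤ p q (to eqv) i ih)
    (content-≤ q p (from eqv) i (sym ∘ ih))

  rowLength-injective : ∀ {xs ys} → All (0 ℕ.<_) xs → All (0 ℕ.<_) ys →
    (∀ i → rowLength xs i ≡ rowLength ys i) → xs ≡ ys
  rowLength-injective []       []       e = refl
  rowLength-injective []       (p ∷ _)  e = ⊥-elim (ℕ.<-irrefl (e 0) p)
  rowLength-injective (p ∷ _)  []       e = ⊥-elim (ℕ.<-irrefl (sym (e 0)) p)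
  rowLength-injective (_ ∷ ps) (_ ∷ qs) e = cong₂ _∷_ (e 0) (rowLength-injective ps qs (e ∘ suc))

  partition-≡ : ∀ {p q} → parts p ≡ parts q → p ≡ q
  partition-≡ {mkPartition xs l a} {mkPartition .xs l′ a′} refl =
    cong₂ (mkPartition xs) (Linked.irrelevant ℕ.≤-irrelevant l l′) (All.irrelevant ℕ.≤-irrelevant a a′)

  beads-injective : ∀ p q → (∀ {x} → Beads p x ⇔ Beads q x) → p ≡ q
  beads-injective p q eqv = partition-≡ (rowLength-injective (positive p) (positive q) λ i →
    ℤ.+-injective (≡-by (content-determined p q eqv i)
      (solve 3 (λ a b i → (a :- i) :- (b :- i) := a :- b) refl
        (+ rowLength (parts p) i) (+ rowLength (parts q) i) (+ i))))
  -- Partitions with prescribed beads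

  rowLength-applyUpTo : ∀ f n i j → j ℕ.< rowLength (applyUpTo f n) i ⇔ (i ℕ.< n × j ℕ.< f i)
  rowLength-applyUpTo f zero    i       j = mk⇔ (λ ()) (λ ())
  rowLength-applyUpTo f (suc n) zero    j = mk⇔ (λ q → z<s , q) proj₂
  rowLength-applyUpTo f (suc n) (suc i) j with rowLength-applyUpTo (f ∘ suc) n i j
  ... | e = mk⇔ (λ q → s≤s (proj₁ (to e q)) , proj₂ (to e q)) (λ { (s≤s a , b) → from e (a , b) })

  rowLength-applyUpTo-< : ∀ f {n i} → i ℕ.< n → rowLength (applyUpTo f n) i ≡ f i
  rowLength-applyUpTo-< f {n} {i} i<n = <-ext λ j → mk⇔
    (proj₂ ∘ to (rowLength-applyUpTo f n i j)) (λ q → from (rowLength-applyUpTo f n i j) (i<n , q))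

  -- Row lengths after a hook with arm and leg N is wrapped around xs.
  border : ℕ → List ℕ → ℕ → ℕ
  border N xs zero    = suc N
  border N xs (suc i) = suc (rowLength xs i)

  addHook : ℕ → List ℕ → List ℕ
  addHook N xs = applyUpTo (border N xs) (suc N)

  -- The bound `N` on the rows, and so by symmetry on the columns, makes room for wrapping a hook
  -- with arm and leg `N` around the diagram.
  record Frame (N : ℕ) (xs : List ℕ) : Set where
    field
      linked    : Linked ℕ._≥_ xs
      pos       : All (0 ℕ.<_) xs
      transpose : ∀ i j → j ℕ.< rowLength xs i → i ℕ.< rowLength xs j
      bound     : ∀ i → rowLength xs i ℕ.≤ N

    toPartition : Partition
    toPartition = mkPartition xs linked pos

    toPartition-selfConjugate : SelfConjugate toPartition
    toPartition-selfConjugate i j = mk⇔ (transpose i j) (transpose j i)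

    support : ∀ {i} → 0 ℕ.< rowLength xs i → i ℕ.< N
    support q = ℕ.<-≤-trans (transpose _ 0 q) (bound 0)

  addHook-frame : ∀ {N xs} → Frame N xs → Frame (suc N) (addHook N xs)
  addHook-frame {N} {xs} fr = record
    { linked    = Linked.applyUpTo⁺₂ (border N xs) (suc N) border-antitone
    ; pos       = All.applyUpTo⁺₂ (border N xs) (suc N) border-pos
    ; transpose = λ i j q → from (row-⇔ j i) (flip i j (to (row-⇔ i j) q))
    ; bound     = λ i → ℕ.≮⇒≥ λ q → ℕ.<-irrefl refl
                    (ℕ.<-≤-trans (proj₂ (to (row-⇔ i (suc N)) q)) (border-bound i))
    }
    where
    open Frame fr
    row-⇔ = rowLength-applyUpTo (border N xs) (suc N)
    border-bound : ∀ i → border N xs i ℕ.≤ suc N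
    border-bound zero    = ℕ.≤-refl
    border-bound (suc i) = s≤s (bound i)
    border-antitone : ∀ i → border N xs (suc i) ℕ.≤ border N xs i
    border-antitone zero    = s≤s (bound 0)
    border-antitone (suc i) = s≤s (rowLength-suc-≤ linked i)
    border-pos : ∀ i → 0 ℕ.< border N xs i
    border-pos zero    = z<s
    border-pos (suc i) = z<s
    flip : ∀ i j → i ℕ.< suc N × j ℕ.< border N xs i → j ℕ.< suc N × i ℕ.< border N xs j
    flip i j (a , b) = ℕ.<-≤-trans b (border-bound i) , go i j a b
      where
      go : ∀ i j → i ℕ.< suc N → j ℕ.< border N xs i → i ℕ.< border N xs j
      go zero    j       a b       = border-pos j
      go (suc i) zero    a b       = a
      go (suc i) (suc j) a (s≤s b) = s≤s (transpose i j b)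

  PositiveBead : List ℕ → ℕ → Set
  PositiveBead xs n = ∃[ i ] rowLength xs i ≡ suc n ℕ.+ i

  addHook-bead : ∀ {N xs} → Frame N xs → ∀ n → PositiveBead (addHook N xs) n ⇔ (n ≡ N ⊎ PositiveBead xs n)
  addHook-bead {N} {xs} fr n = mk⇔ f g
    where
    open Frame fr
    f : PositiveBead (addHook N xs) n → n ≡ N ⊎ PositiveBead xs n
    f (zero , e)  = inj₁ (sym (ℕ.suc-injective (trans e (ℕ.+-identityʳ (suc n)))))
    f (suc i , e) = inj₂ (i , ℕ.suc-injective
      (trans (sym (rowLength-applyUpTo-< (border N xs) (proj₁ (to (rowLength-applyUpTo (border N xs) (suc N) (suc i) 0)
        (subst (0 ℕ.<_) (sym e) z<s))))) (trans e (ℕ.+-suc (suc n) i))))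
    g : n ≡ N ⊎ PositiveBead xs n → PositiveBead (addHook N xs) n
    g (inj₁ refl)    = 0 , sym (ℕ.+-identityʳ (suc n))
    g (inj₂ (i , e)) = suc i , trans
      (rowLength-applyUpTo-< (border N xs) (s≤s (support (subst (0 ℕ.<_) (sym e) z<s))))
      (trans (cong suc e) (sym (ℕ.+-suc (suc n) i)))

  positiveBead⇔ : ∀ p n → PositiveBead (parts p) n ⇔ Beads p (+ suc n)
  positiveBead⇔ p n = mk⇔
    (λ { (i , e) → i , trans (cong (λ r → + r - + i) e)
         (solve 2 (λ n i → (n :+ i) :- i := n) refl (+ suc n) (+ i)) })
    (λ { (i , e) → i , ℤ.+-injective (≡-by e
         (solve 3 (λ r n i → (r :- i) :- n := r :- (n :+ i)) refl (+ rowLength (parts p) i) (+ suc n) (+ i))) })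

  -- Exactly one of x and 1 - x is positive, so a symmetric set is determined by its positive
  -- elements.
  symmetric-⊆ : ∀ {T U} → Symmetric T → Symmetric U → (∀ n → T (+ suc n) ⇔ U (+ suc n)) → ∀ {x} → T x → U x
  symmetric-⊆ ST SU eqv {+ suc n} t = to (eqv n) t
  symmetric-⊆ {T} {U} ST SU eqv {+ zero} t with covering SU (+ 0)
  ... | inj₁ u = u
  ... | inj₂ u = ⊥-elim (exclusive ST t (from (eqv 0) u) refl)
  symmetric-⊆ {T} {U} ST SU eqv { -[1+ n ] } t with covering SU -[1+ n ]
  ... | inj₁ u = u
  ... | inj₂ u = ⊥-elim (exclusive ST t (from (eqv (suc n)) u)
         (solve 1 (λ x → x :+ (con 1ℤ :- x) := con 1ℤ) refl -[1+ n ]))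

  module _ {T : ℤ → Set} (T? : ∀ x → Dec (T x)) where

    -- These are Frobenius coordinates: a positive bead n + 1 is a diagonal hook with arm and leg n.
    -- The hooks are wrapped from the inside to the outside.
    fromBeads : ℕ → List ℕ
    fromBeads zero = []
    fromBeads (suc N) with T? (+ suc N)
    ... | yes _ = addHook N (fromBeads N)
    ... | no  _ = fromBeads N

    fromBeads-frame : ∀ N → Frame N (fromBeads N)
    fromBeads-frame zero = record { linked = [] ; pos = [] ; transpose = λ _ _ () ; bound = λ _ → z≤n }
    fromBeads-frame (suc N) with T? (+ suc N)
    ... | yes _ = addHook-frame (fromBeads-frame N)
    ... | no  _ = record { Frame (fromBeads-frame N) ; bound = λ i → ℕ.m≤n⇒m≤1+n (Frame.bound (fromBeads-frame N) i) }

    fromBeads-bead : ∀ N n → PositiveBead (fromBeads N) n ⇔ (n ℕ.< N × T (+ suc n))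
    fromBeads-bead zero    n = mk⇔ (λ { (_ , ()) }) (λ ())
    fromBeads-bead (suc N) n with T? (+ suc N)
    ... | yes t = mk⇔ (f ∘ to (addHook-bead (fromBeads-frame N) n)) (from (addHook-bead (fromBeads-frame N) n) ∘ g)
      where
      f : n ≡ N ⊎ PositiveBead (fromBeads N) n → n ℕ.< suc N × T (+ suc n)
      f (inj₁ refl) = ℕ.≤-refl , t
      f (inj₂ b) with to (fromBeads-bead N n) b
      ... | l , u = ℕ.m≤n⇒m≤1+n l , u
      g : n ℕ.< suc N × T (+ suc n) → n ≡ N ⊎ PositiveBead (fromBeads N) n
      g (l , u) with ℕ.m≤n⇒m<n∨m≡n (ℕ.≤-pred l)
      ... | inj₁ n<N = inj₂ (from (fromBeads-bead N n) (n<N , u))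
      ... | inj₂ n≡N = inj₁ n≡N
    ... | no ¬t = mk⇔ (λ b → ℕ.m≤n⇒m≤1+n (proj₁ (to (fromBeads-bead N n) b)) , proj₂ (to (fromBeads-bead N n) b)) g
      where
      g : n ℕ.< suc N × T (+ suc n) → PositiveBead (fromBeads N) n
      g (l , u) with ℕ.m≤n⇒m<n∨m≡n (ℕ.≤-pred l)
      ... | inj₁ n<N  = from (fromBeads-bead N n) (n<N , u)
      ... | inj₂ refl = ⊥-elim (¬t u)

    fromBeadsₚ : ℕ → Partition
    fromBeadsₚ N = Frame.toPartition (fromBeads-frame N)

    fromBeads-selfConjugate : ∀ N → SelfConjugate (fromBeadsₚ N)
    fromBeads-selfConjugate N = Frame.toPartition-selfConjugate (fromBeads-frame N)

    fromBeads-beads : Symmetric T → ∀ {N} → (∀ {x} → T x → x ≤ + N) → ∀ {x} → Beads (fromBeadsₚ N) x ⇔ T x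
    fromBeads-beads ST {N} bnd = mk⇔
      (symmetric-⊆ SB ST eqv)
      (symmetric-⊆ ST SB λ n → mk⇔ (from (eqv n)) (to (eqv n)))
      where
      SB : Symmetric (Beads (fromBeadsₚ N))
      SB = beads-symmetric (fromBeadsₚ N) (fromBeads-selfConjugate N)
      eqv : ∀ n → Beads (fromBeadsₚ N) (+ suc n) ⇔ T (+ suc n)
      eqv n = mk⇔
        (λ b → proj₂ (to (fromBeads-bead N n) (from (positiveBead⇔ (fromBeadsₚ N) n) b)))
        (λ t → to (positiveBead⇔ (fromBeadsₚ N) n) (from (fromBeads-bead N n) (ℤ.drop‿+≤+ (bnd t) , t)))
  -- Profiles of symmetric sets of integers

  i≤+∣i∣ : ∀ i → i ≤ + ∣ i ∣
  i≤+∣i∣ (+ n)    = ℤ.≤-refl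
  i≤+∣i∣ -[1+ n ] = -≤+

  ≤⇒∃+ : ∀ {i j} → i ≤ j → ∃[ n ] j ≡ i + + n
  ≤⇒∃+ {i} {j} p = ∣ j - i ∣ , ≡-by (sym (ℤ.0≤i⇒+∣i∣≡i (ℤ.i≤j⇒0≤j-i p)))
    (solve 3 (λ i j n → j :- i :- n := j :- (i :+ n)) refl i j (+ ∣ j - i ∣))

  symmetric-dec : ∀ {T} → Symmetric T → ∀ x → Dec (T x)
  symmetric-dec ST x with covering ST x
  ... | inj₁ t = yes t
  ... | inj₂ u = no λ t → exclusive ST t u (solve 1 (λ x → x :+ (con 1ℤ :- x) := con 1ℤ) refl x)

  module _ {T : ℤ → Set} (T? : ∀ i → Dec (T i)) (down : ∀ {i} → T i → T (i - + 1)) where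

    down-≤ : ∀ {i j} → i ≤ j → T j → T i
    down-≤ {i} {j} i≤j t with ≤⇒∃+ i≤j
    ... | n , refl = go n t
      where
      go : ∀ n → T (i + + n) → T i
      go zero    t = subst T (ℤ.+-identityʳ i) t
      go (suc n) t = go n (subst T (solve 2 (λ i n → i :+ (con 1ℤ :+ n) :- con 1ℤ := i :+ n) refl i (+ n)) (down t))

    threshold : ∀ {lo hi} → T lo → ¬ T hi → ∃[ h ] (∀ i → T i ⇔ i ≤ h)
    threshold {lo} {hi} tlo ¬thi with lo ℤ.≤? hi
    ... | no lo≰hi = ⊥-elim (¬thi (down-≤ (ℤ.<⇒≤ (ℤ.≰⇒> lo≰hi)) tlo))
    ... | yes lo≤hi with ≤⇒∃+ lo≤hi
    ... | n , refl = go n ¬thi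
      where
      go : ∀ n → ¬ T (lo + + n) → ∃[ h ] (∀ i → T i ⇔ i ≤ h)
      go zero    ¬t = ⊥-elim (¬t (subst T (sym (ℤ.+-identityʳ lo)) tlo))
      go (suc n) ¬t with T? (lo + + n)
      ... | no ¬t′ = go n ¬t′
      ... | yes t  = lo + + n , λ i → mk⇔
        (λ ti → ℤ.≮⇒≥ λ q → ¬t (down-≤ (≤-by (<⇒+1≤ q)
            (solve 3 (λ l n i → i :- (l :+ n :+ con 1ℤ) := i :- (l :+ (con 1ℤ :+ n))) refl lo (+ n) i)) ti))
        (λ q → down-≤ q t)

  -- The integers are arranged in columns modulo (s , - d), with x = j d + i s + c in
  -- column j at height i; x ↦ 1 - x becomes (j , i) ↦ (α - j , β - i).
  module Grid (s d : ℕ) .{{s≢0 : NonZero s}} (u v α β c : ℤ)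
    (bezout : u * + d + v * + s ≡ 1ℤ) (centre : c + c + (α * + d + β * + s) ≡ 1ℤ) where

    site : ℤ → ℤ → ℤ
    site j i = j * + d + i * + s + c

    -- Addresses of an integer differ by multiples of (s, - d). The Bézout coefficients select one
    -- of them.
    column height : ℤ → ℤ
    column x = u * (x - c)
    height x = v * (x - c)

    site-column-height : ∀ x → site (column x) (height x) ≡ x
    site-column-height x = ≡-by (cong (λ e → e * (x - c)) bezout)
      (solve 6 (λ u v d s x c → (u :* d :+ v :* s) :* (x :- c) :- con 1ℤ :* (x :- c)
          := u :* (x :- c) :* d :+ v :* (x :- c) :* s :+ c :- x) refl u v (+ d) (+ s) x c)

    site-reflect : ∀ j i → 1ℤ - site j i ≡ site (α - j) (β - i)
    site-reflect j i = ≡-by (sym centre)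
      (solve 7 (λ j i α β d s c → con 1ℤ :- (c :+ c :+ (α :* d :+ β :* s))
          := con 1ℤ :- (j :* d :+ i :* s :+ c) :- ((α :- j) :* d :+ (β :- i) :* s :+ c))
        refl j i α β (+ d) (+ s) c)

    -- Subtracting s + k d moves `k` columns back and one step down, which is why closure compares
    -- h(j + k) with h(j) + 1.
    site-shift : ∀ j i k n → + n ≡ + s + k * + d → site (j + k) i - + n ≡ site j (i - + 1)
    site-shift j i k n e = trans (cong (λ n → site (j + k) i - n) e)
      (solve 6 (λ j i k d s c → (j :+ k) :* d :+ i :* s :+ c :- (s :+ k :* d)
          := j :* d :+ (i :- con 1ℤ) :* s :+ c) refl j i k (+ d) (+ s) c)

    site-wrap : ∀ j i n → site (j + n * + s) i ≡ site j (i + n * + d)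
    site-wrap j i n = solve 6 (λ j i n d s c → (j :+ n :* s) :* d :+ i :* s :+ c
          := j :* d :+ (i :+ n :* d) :* s :+ c) refl j i n (+ d) (+ s) c

    -- The first law says that (j + n s, i) and (j, i + n d) are the same integer. The second comes
    -- from x ↦ 1 - x: the heights missing in column j start at h(j) + 1, so the mirror column is
    -- filled up to β - (h(j) + 1).
    record Profile (h : ℤ → ℤ) : Set where
      field
        quasiperiodic : ∀ j n → h (j + n * + s) ≡ h j - n * + d
        antisymmetric : ∀ j → h j + h (α - j) ≡ β - 1ℤ

    Climb : (ℤ → ℤ) → ℤ → Set
    Climb h k = ∀ j → h (j + k) ≤ h j + 1ℤ

    Below : (ℤ → ℤ) → ℤ → Set
    Below h x = height x ≤ h (column x)

    Below? : ∀ h x → Dec (Below h x)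
    Below? h x = height x ℤ.≤? h (column x)

    module _ {h : ℤ → ℤ} (P : Profile h) where
      open Profile P

      -- `Below` tests a single address of an integer. By Bézout u (j d + i s) = j + (u i - v j) s,
      -- so that address is `n` periods away from (j, i), and quasiperiodicity carries the test
      -- over.
      below-site : ∀ j i → Below h (site j i) ⇔ i ≤ h j
      below-site j i = mk⇔
        (λ p → ≤-by (subst₂ _≤_ height≡ (trans (cong h column≡) (quasiperiodic j n)) p)
           (solve 3 (λ h i m → h :- m :- (i :- m) := h :- i) refl (h j) i (n * + d)))
        (λ p → subst₂ _≤_ (sym height≡) (sym (trans (cong h column≡) (quasiperiodic j n)))
           (ℤ.+-monoˡ-≤ (- (n * + d)) p))
        where
        n : ℤ
        n = u * i - v * j
        column≡ : column (site j i) ≡ j + n * + s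
        column≡ = ≡-by (cong (λ e → e * j) bezout)
          (solve 7 (λ u v d s j i c → (u :* d :+ v :* s) :* j :- con 1ℤ :* j
             := u :* (j :* d :+ i :* s :+ c :- c) :- (j :+ (u :* i :- v :* j) :* s)) refl u v (+ d) (+ s) j i c)
        height≡ : height (site j i) ≡ i - n * + d
        height≡ = ≡-by (cong (λ e → e * i) bezout)
          (solve 7 (λ u v d s j i c → (u :* d :+ v :* s) :* i :- con 1ℤ :* i
             := v :* (j :* d :+ i :* s :+ c :- c) :- (i :- (u :* i :- v :* j) :* d)) refl u v (+ d) (+ s) j i c)

      below-symmetric : Symmetric (Below h)
      below-symmetric .exclusive {x} {y} bx by e = ℤ.<-irrefl refl (+1≤⇒< {0ℤ} {0ℤ} (≤-by
          (ℤ.+-mono-≤ bx (to (below-site (α - j) (β - i)) (subst (Below h) y≡ by)))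
          (trans (cong (λ e → e - (i + (β - i))) (antisymmetric j))
             (solve 2 (λ β i → β :- con 1ℤ :- (i :+ (β :- i)) := con 0ℤ :- (con 0ℤ :+ con 1ℤ)) refl β i))))
        where
        j = column x
        i = height x
        y≡ : y ≡ site (α - j) (β - i)
        y≡ = trans (≡-by e (solve 2 (λ x y → x :+ y :- con 1ℤ := y :- (con 1ℤ :- x)) refl x y))
          (trans (cong (λ x → 1ℤ - x) (sym (site-column-height x))) (site-reflect j i))
      below-symmetric .covering x with height x ℤ.≤? h (column x)
      ... | yes b = inj₁ b
      ... | no ¬b = inj₂ (subst (Below h) y≡ (from (below-site (α - j) (β - i)) (≤-by
          (<⇒+1≤ (ℤ.≰⇒> ¬b))
          (≡-by (sym (antisymmetric j)) (solve 4 (λ β h h′ i → β :- con 1ℤ :- (h :+ h′)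
              := i :- (h :+ con 1ℤ) :- (h′ :- (β :- i))) refl β (h j) (h (α - j)) i)))))
        where
        j = column x
        i = height x
        y≡ : site (α - j) (β - i) ≡ 1ℤ - x
        y≡ = trans (sym (site-reflect j i)) (cong (λ x → 1ℤ - x) (site-column-height x))

      closed⇒climb : ∀ {k n} → + n ≡ + s + k * + d → Closed (Below h) n → Climb h k
      closed⇒climb {k} {n} e cl j = ≤-by
        (to (below-site j (h (j + k) - 1ℤ)) (subst (Below h) (site-shift j (h (j + k)) k n e)
           (cl {site (j + k) (h (j + k))} (from (below-site (j + k) (h (j + k))) ℤ.≤-refl))))
        (solve 2 (λ a b → a :- (b :- con 1ℤ) := a :+ con 1ℤ :- b) refl (h j) (h (j + k)))

      climb⇒closed : ∀ {k n} → + n ≡ + s + k * + d → Climb h k → Closed (Below h) n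
      climb⇒closed {k} {n} e cl {x} b = subst (Below h) x≡ (from (below-site (j - k) (height x - 1ℤ)) (≤-by
          (ℤ.≤-trans b (subst (λ l → h l ≤ h (j - k) + 1ℤ) j-k+k (cl (j - k))))
          (solve 2 (λ a b → a :+ con 1ℤ :- b := a :- (b :- con 1ℤ)) refl (h (j - k)) (height x))))
        where
        j = column x
        j-k+k : j - k + k ≡ j
        j-k+k = solve 2 (λ j k → j :- k :+ k := j) refl j k
        x≡ : site (j - k) (height x - 1ℤ) ≡ x - + n
        x≡ = trans (sym (site-shift (j - k) (height x) k n e))
          (cong (λ x → x - + n) (trans (cong (λ l → site l (height x)) j-k+k) (site-column-height x)))

    bound : (ℤ → ℤ) → ℕ
    bound h = ∣ + s * + d + (h 0ℤ + + s) * + s + c ∣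

    -- Every integer has an address in a column r with 0 ≤ r < s, where h(r) ≤ h(0) + r because each
    -- step climbs by at most 1.
    below-bounded : ∀ {h} → Profile h → Climb h 1ℤ → ∀ {x} → Below h x → x ≤ + bound h
    below-bounded {h} P cl {x} b = ℤ.≤-trans (subst (_≤ + s * + d + (h 0ℤ + + s) * + s + c) x≡ site≤) (i≤+∣i∣ _)
      where
      r : ℕ
      r = column x %ℕ s
      q i : ℤ
      q = column x /ℕ s
      i = height x + q * + d
      r≤s : r ℕ.≤ s
      r≤s = ℕ.<⇒≤ (n%ℕd<d (column x) s)
      x≡ : site (+ r) i ≡ x
      x≡ = trans (sym (site-wrap (+ r) (height x) q))
        (trans (cong (λ j → site j (height x)) (sym (a≡a%ℕn+[a/ℕn]*n (column x) s))) (site-column-height x))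
      climbs : ∀ n → h (+ n) ≤ h 0ℤ + + n
      climbs zero    = ℤ.≤-reflexive (sym (ℤ.+-identityʳ _))
      climbs (suc n) = ℤ.≤-trans (subst (λ j → h j ≤ h (+ n) + 1ℤ) (ℤ.+-comm (+ n) 1ℤ) (cl (+ n)))
        (≤-by (climbs n) (solve 3 (λ a b n → a :+ n :- b := a :+ (con 1ℤ :+ n) :- (b :+ con 1ℤ)) refl (h 0ℤ) (h (+ n)) (+ n)))
      i≤ : i ≤ h 0ℤ + + s
      i≤ = ℤ.≤-trans (to (below-site P (+ r) i) (subst (Below h) (sym x≡) b))
        (ℤ.≤-trans (climbs r) (ℤ.+-monoʳ-≤ (h 0ℤ) (+≤+ r≤s)))
      site≤ : site (+ r) i ≤ + s * + d + (h 0ℤ + + s) * + s + c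
      site≤ = ℤ.+-monoˡ-≤ c (ℤ.+-mono-≤ (ℤ.*-monoʳ-≤-nonNeg (+ d) (+≤+ r≤s)) (ℤ.*-monoʳ-≤-nonNeg (+ s) i≤))

    below-injective : ∀ {h h′} → Profile h → Profile h′ → (∀ {x} → Below h x ⇔ Below h′ x) → ∀ j → h j ≡ h′ j
    below-injective P P′ eqv j = ≤-ext
      (λ i q → to (below-site P′ j i) (to (eqv {site j i}) (from (below-site P j i) q)))
      (λ i q → to (below-site P j i) (from (eqv {site j i}) (from (below-site P′ j i) q)))

    module _ {T : ℤ → Set} (ST : Symmetric T) (closed : Closed T s) {N : ℕ} (bnd : ∀ {x} → T x → x ≤ + N) where

      private
        down : ∀ j {i} → T (site j i) → T (site j (i - 1ℤ))
        down j {i} t = subst T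
          (solve 5 (λ j i d s c → j :* d :+ i :* s :+ c :- s := j :* d :+ (i :- con 1ℤ) :* s :+ c) refl j i (+ d) (+ s) c)
          (closed t)

        -- Chosen so that the site exceeds `N`: as s ≥ 1 and `top j` is positive, `top j * s` is at
        -- least `top j`, which outweighs the offset j d + c.
        top : ℤ → ℤ
        top j = + suc (N ℕ.+ ∣ j * + d + c ∣)

        ¬top : ∀ j → ¬ T (site j (top j))
        ¬top j t = ℤ.<-irrefl refl (+1≤⇒< {+ N} {+ N} (ℤ.≤-trans lower (bnd t)))
          where
          e = j * + d + c
          -e≤ : - e ≤ + ∣ e ∣
          -e≤ = subst (λ n → - e ≤ + n) (ℤ.∣-i∣≡∣i∣ e) (i≤+∣i∣ (- e))
          top≤ : top j ≤ top j * + s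
          top≤ = subst (_≤ top j * + s) (ℤ.*-identityʳ (top j))
            (ℤ.*-monoˡ-≤-nonNeg (top j) (+≤+ (ℕ.>-nonZero⁻¹ s)))
          lower : + N + 1ℤ ≤ site j (top j)
          lower = ≤-by (ℤ.+-mono-≤ -e≤ top≤)
            (solve 6 (λ jd ts c N a t → a :+ ts :- (:- (jd :+ c) :+ (con 1ℤ :+ (N :+ a)))
               := jd :+ ts :+ c :- (N :+ con 1ℤ)) refl (j * + d) (top j * + s) c (+ N) (+ ∣ e ∣) (top j))

        -- The set is only assumed to be bounded above. Its columns are filled far below because
        -- their mirror images are empty far above.
        bottom : ∀ j → T (site j (β - top (α - j)))
        bottom j with covering ST (site j (β - top (α - j)))
        ... | inj₁ t = t
        ... | inj₂ t = ⊥-elim (¬top (α - j) (subst T (trans (site-reflect j _) (cong (site (α - j))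
                 (solve 2 (λ β t → β :- (β :- t) := t) refl β (top (α - j))))) t))

        abstract
          tops : ∀ j → ∃[ h ] (∀ i → T (site j i) ⇔ i ≤ h)
          tops j = threshold (λ i → symmetric-dec ST (site j i)) (λ {i} → down j {i})
            {β - top (α - j)} {top j} (bottom j) (¬top j)

      profileOf : ℤ → ℤ
      profileOf j = proj₁ (tops j)

      profileOf-site : ∀ j i → T (site j i) ⇔ i ≤ profileOf j
      profileOf-site j = proj₂ (tops j)

      profileOf-profile : Profile profileOf
      profileOf-profile = record
        { quasiperiodic = λ j n → ≤-ext
            (λ i q → ≤-by (to (profileOf-site j (i + n * + d)) (subst T (site-wrap j i n) (from (profileOf-site (j + n * + s) i) q)))
               (solve 3 (λ h i m → h :- (i :+ m) := h :- m :- i) refl (profileOf j) i (n * + d)))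
            (λ i q → to (profileOf-site (j + n * + s) i) (subst T (sym (site-wrap j i n)) (from (profileOf-site j (i + n * + d))
               (≤-by q (solve 3 (λ h i m → h :- m :- i := h :- (i :+ m)) refl (profileOf j) i (n * + d))))))
        ; antisymmetric = λ j → ℤ.≤-antisym (upper j) (lower j)
        }
        where
        upper : ∀ j → profileOf j + profileOf (α - j) ≤ β - 1ℤ
        upper j = ℤ.≮⇒≥ λ q → exclusive ST
          (from (profileOf-site j (profileOf j)) ℤ.≤-refl)
          (from (profileOf-site (α - j) (β - profileOf j)) (≤-by (<⇒+1≤ q)
            (solve 3 (λ h h′ β → h :+ h′ :- (β :- con 1ℤ :+ con 1ℤ) := h′ :- (β :- h)) refl (profileOf j) (profileOf (α - j)) β)))
          (trans (cong (λ y → site j (profileOf j) + y) (sym (site-reflect j (profileOf j))))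
            (solve 1 (λ x → x :+ (con 1ℤ :- x) := con 1ℤ) refl (site j (profileOf j))))
        lower : ∀ j → β - 1ℤ ≤ profileOf j + profileOf (α - j)
        lower j with covering ST (site j (profileOf j + 1ℤ))
        ... | inj₁ t = ⊥-elim (ℤ.<-irrefl refl (+1≤⇒< {profileOf j} (to (profileOf-site j (profileOf j + 1ℤ)) t)))
        ... | inj₂ t = ≤-by (to (profileOf-site (α - j) (β - (profileOf j + 1ℤ))) (subst T (site-reflect j (profileOf j + 1ℤ)) t))
            (solve 3 (λ h h′ β → h′ :- (β :- (h :+ con 1ℤ)) := h :+ h′ :- (β :- con 1ℤ)) refl (profileOf j) (profileOf (α - j)) β)

      below-profileOf : ∀ {x} → T x ⇔ Below profileOf x
      below-profileOf {x} = mk⇔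
        (λ t → to (profileOf-site (column x) (height x)) (subst T (sym (site-column-height x)) t))
        (λ b → subst T (site-column-height x) (from (profileOf-site (column x) (height x)) b))

  -- Words and their letters

  -- Recovers the heights from the letters by h(j + 1) = h(j) + 1 - a(j).
  walk : ℤ → List ℕ → ℕ → ℤ
  walk z l       zero    = z
  walk z []      (suc i) = z
  walk z (a ∷ l) (suc i) = walk (z + 1ℤ - + a) l i

  walk-injective : ∀ {l l′} z → length l ≡ length l′ → (∀ i → i ℕ.≤ length l → walk z l i ≡ walk z l′ i) → l ≡ l′
  walk-injective {[]}    {[]}      z e w = refl
  walk-injective {a ∷ l} {a′ ∷ l′} z e w = cong₂ _∷_ a≡a′
    (walk-injective (z + 1ℤ - + a) (ℕ.suc-injective e) λ i i≤ →
      trans (w (suc i) (s≤s i≤)) (cong (λ a → walk (z + 1ℤ - + a) l′ i) (sym a≡a′)))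
    where
    a≡a′ : a ≡ a′
    a≡a′ = ℤ.+-injective (≡-by (sym (w 1 (s≤s z≤n)))
      (solve 3 (λ z a b → z :+ con 1ℤ :- b :- (z :+ con 1ℤ :- a) := a :- b) refl z (+ a) (+ a′)))

  word-length : ∀ {ε σ k M l} → Word ε σ k M l → length l ≡ k
  word-length end-free         = refl
  word-length (end-blocked _)  = refl
  word-length (end-nonzero _)  = refl
  word-length (free-zero w)    = cong suc (word-length w)
  word-length (free-suc w)     = word-length w
  word-length (blocked-one w)  = cong suc (word-length w)
  word-length (blocked-suc w)  = word-length w
  word-length (nonzero-one w)  = cong suc (word-length w)
  word-length (nonzero-suc w)  = word-length w

  nonzero-word : ∀ {ε k M l} a → Word ε free k M l → Word ε nonzero (suc k) (suc a ℕ.+ M) (suc a ∷ l)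
  nonzero-word zero    w = nonzero-one w
  nonzero-word (suc a) w = nonzero-suc (nonzero-word a w)

  -- `Word` builds its letters in unary. This view splits off a whole first letter and shows the
  -- state that it leaves behind.
  data Uncons (ε : ℕ) : State → ℕ → ℕ → List ℕ → Set where
    free-0    : ∀ {k M l} → Word ε blocked k M l → Uncons ε free (suc k) M (0 ∷ l)
    free-1+   : ∀ {k M l} a → Word ε free k M l → Uncons ε free (suc k) (suc a ℕ.+ M) (suc a ∷ l)
    blocked-1 : ∀ {k M l} → Word ε nonzero k M l → Uncons ε blocked (suc k) (suc M) (1 ∷ l)
    blocked-2+ : ∀ {k M l} a → Word ε free k M l → Uncons ε blocked (suc k) (suc (suc a) ℕ.+ M) (suc (suc a) ∷ l)
    nonzero-1+ : ∀ {k M l} a → Word ε free k M l → Uncons ε nonzero (suc k) (suc a ℕ.+ M) (suc a ∷ l)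

  uncons : ∀ {ε σ k M l} → Word ε σ (suc k) M l → Uncons ε σ (suc k) M l
  uncons (free-zero w)   = free-0 w
  uncons (free-suc w) with uncons w
  ... | nonzero-1+ a w′ = free-1+ a w′
  uncons (blocked-one w) = blocked-1 w
  uncons (blocked-suc w) with uncons w
  ... | nonzero-1+ a w′ = blocked-2+ a w′
  uncons (nonzero-one w) = nonzero-1+ 0 w
  uncons (nonzero-suc w) with uncons w
  ... | nonzero-1+ a w′ = nonzero-1+ (suc a) w′

  -- The index `M` is the sum of the letters before the centre plus the b of the central letter 2 b
  -- + ε.
  data Spells (ε : ℕ) : (ℕ → ℤ) → ℕ → ℕ → List ℕ → Set where
    last : ∀ {f M} → f 0 ≡ + (M ℕ.+ M ℕ.+ ε) → Spells ε f 0 M []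
    next : ∀ {f k M l} a → f 0 ≡ + a → Spells ε (f ∘ suc) k M l → Spells ε f (suc k) (a ℕ.+ M) (a ∷ l)

  -- The sum conditions that reach back before the start: `blocked` is what a preceding 0 leaves of
  -- `double` and `triple`, and `nonzero` is what a preceding 0 1 leaves of `triple`.
  Lead : State → (ℕ → ℤ) → Set
  Lead free    f = ⊤
  Lead blocked f = 1ℤ ≤ f 0 × + 2 ≤ f 0 + f 1
  Lead nonzero f = 1ℤ ≤ f 0

  -- By telescoping, `Climb h k` says that any k consecutive letters have sum at least k - 1. The
  -- last instance of `triple` reaches one letter beyond the centre.
  record Admissible (σ : State) (k : ℕ) (f : ℕ → ℤ) : Set where
    field
      single : ∀ {i} → i ℕ.≤ k → 0ℤ ≤ f i
      double : ∀ {i} → i ℕ.< k → 1ℤ ≤ f i + f (suc i)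
      triple : ∀ {i} → i ℕ.< k → + 2 ≤ f i + f (suc i) + f (suc (suc i))
      lead   : Lead σ f

  open Admissible public

  -- The centre is at position k. If k = 0, its right neighbour mirrors the letter before the start,
  -- of which only the state `blocked` has a record.
  Mirror : State → ℕ → (ℕ → ℤ) → Set
  Mirror σ zero    f = σ ≡ blocked → f 1 ≡ 0ℤ
  Mirror σ (suc k) f = f (suc (suc k)) ≡ f k

  mirror-suc : ∀ {σ k} (f : ℕ → ℤ) → f (suc (suc k)) ≡ f k → (σ ≡ blocked → f 0 ≡ 0ℤ) → Mirror σ k (f ∘ suc)
  mirror-suc {k = zero}  f m z e = trans m (z e)
  mirror-suc {k = suc k} f m z   = m

  admissible-tail : ∀ {σ σ′ k f} → Admissible σ (suc k) f → Lead σ′ (f ∘ suc) → Admissible σ′ k (f ∘ suc)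
  admissible-tail A l = record
    { single = single A ∘ s≤s ; double = double A ∘ s≤s ; triple = triple A ∘ s≤s ; lead = l }

  admissible-cons : ∀ {σ σ′ k f} → 0ℤ ≤ f 0 → 1ℤ ≤ f 0 + f 1 → + 2 ≤ f 0 + f 1 + f 2 → Lead σ f →
    Admissible σ′ k (f ∘ suc) → Admissible σ (suc k) f
  admissible-cons s d t l A = record
    { single = λ { {zero} _ → s ; {suc i} (s≤s p) → single A p }
    ; double = λ { {zero} _ → d ; {suc i} (s≤s p) → double A p }
    ; triple = λ { {zero} _ → t ; {suc i} (s≤s p) → triple A p }
    ; lead   = l
    }

  admissible⇒word : ∀ {ε σ k f M l} → Spells ε f k M l → Mirror σ k f → Admissible σ k f → Word ε σ k M l
  admissible⇒word {σ = free}    (last e) m A = end-free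
  admissible⇒word {σ = blocked} (last e) m A = end-blocked (ℤ.drop‿+≤+
    (subst (+ 2 ≤_) (trans (cong₂ _+_ e (m refl)) (ℤ.+-identityʳ _)) (proj₂ (lead A))))
  admissible⇒word {σ = nonzero} (last e) m A = end-nonzero (ℤ.drop‿+≤+ (subst (1ℤ ≤_) e (lead A)))
  admissible⇒word {σ = free} {f = f} (next zero e sp) m A = free-zero (admissible⇒word sp
    (mirror-suc f m (λ _ → e)) (admissible-tail A
      ( subst (1ℤ ≤_) (trans (cong (_+ f 1) e) (ℤ.+-identityˡ (f 1))) (double A (s≤s z≤n))
      , subst (+ 2 ≤_) (trans (cong (λ x → x + f 1 + f 2) e) (cong (_+ f 2) (ℤ.+-identityˡ (f 1)))) (triple A (s≤s z≤n)))))
  admissible⇒word {σ = free} {f = f} (next (suc a) e sp) m A =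
    free-suc (nonzero-word a (admissible⇒word sp (mirror-suc f m λ ()) (admissible-tail A tt)))
  admissible⇒word {σ = blocked} (next zero e sp) m A with subst (1ℤ ≤_) e (proj₁ (lead A))
  ... | +≤+ ()
  admissible⇒word {σ = blocked} {f = f} (next (suc zero) e sp) m A =
    blocked-one (admissible⇒word sp (mirror-suc f m λ ()) (admissible-tail A
      (≤-by (subst (λ x → + 2 ≤ x + f 1) e (proj₂ (lead A))) (solve 1 (λ x → con 1ℤ :+ x :- con (+ 2) := x :- con 1ℤ) refl (f 1)))))
  admissible⇒word {σ = blocked} {f = f} (next (suc (suc a)) e sp) m A =
    blocked-suc (nonzero-word a (admissible⇒word sp (mirror-suc f m λ ()) (admissible-tail A tt)))
  admissible⇒word {σ = nonzero} (next zero e sp) m A with subst (1ℤ ≤_) e (lead A)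
  ... | +≤+ ()
  admissible⇒word {σ = nonzero} {f = f} (next (suc a) e sp) m A =
    nonzero-word a (admissible⇒word sp (mirror-suc f m λ ()) (admissible-tail A tt))

  -- If position 1 is already the centre, `double` does not reach f 2, but f 2 is then the mirror
  -- image of the positive f 0.
  admissible-1≤f1+f2 : ∀ {σ k} {f : ℕ → ℤ} → f (suc (suc k)) ≡ f k → 1ℤ ≤ f 0 → Admissible σ k (f ∘ suc) → 1ℤ ≤ f 1 + f 2
  admissible-1≤f1+f2 {k = zero} {f} m 1≤f0 A =
    ℤ.+-mono-≤ {0ℤ} {f 1} {1ℤ} (single A z≤n) (subst (1ℤ ≤_) (sym m) 1≤f0)
  admissible-1≤f1+f2 {k = suc k} m 1≤f0 A = double A (s≤s z≤n)

  -- Neither forbidden pattern begins with a positive letter, so prepending one creates no new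
  -- occurrence.
  admissible-cons-≥1 : ∀ {σ σ′ k} (f : ℕ → ℤ) → f (suc (suc k)) ≡ f k → 1ℤ ≤ f 0 → Lead σ f →
    Admissible σ′ k (f ∘ suc) → Admissible σ (suc k) f
  admissible-cons-≥1 {k = k} f m 1≤f0 l A = admissible-cons
    (ℤ.≤-trans (+≤+ z≤n) 1≤f0)
    (ℤ.+-mono-≤ {1ℤ} {f 0} {0ℤ} 1≤f0 (single A z≤n))
    (≤-by (ℤ.+-mono-≤ 1≤f0 (admissible-1≤f1+f2 {k = k} {f} m 1≤f0 A))
      (solve 3 (λ x y z → x :+ (y :+ z) :- con (+ 2) := x :+ y :+ z :- con (+ 2)) refl (f 0) (f 1) (f 2)))
    l A

  ≡⇒≤ : ∀ {x} n {m} → n ℕ.≤ m → x ≡ + m → + n ≤ x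
  ≡⇒≤ n n≤m e = subst (+ n ≤_) (sym e) (+≤+ n≤m)

  word⇒admissible : ∀ {ε σ k f M l} → Spells ε f k M l → Mirror σ k f → Word ε σ k M l → Admissible σ k f
  word⇒admissible-next : ∀ {ε σ k f M M′ l l′ a} → f 0 ≡ + a → Spells ε (f ∘ suc) k M l → Mirror σ (suc k) f →
    Uncons ε σ (suc k) M′ l′ → l′ ≡ a ∷ l → M′ ≡ a ℕ.+ M → Admissible σ (suc k) f

  word⇒admissible {ε = ε} {σ = σ} {f = f} (last {M = M} e) m w = record
    { single = λ { z≤n → subst (0ℤ ≤_) (sym e) (+≤+ z≤n) } ; double = λ () ; triple = λ () ; lead = end w m }
    where
    end : ∀ {σ} → Word ε σ 0 M [] → Mirror σ 0 f → Lead σ f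
    end end-free        m = tt
    end (end-blocked p) m = ≡⇒≤ 1 (ℕ.<⇒≤ p) e
      , subst (+ 2 ≤_) (sym (trans (cong (λ x → f 0 + x) (m refl)) (ℤ.+-identityʳ (f 0)))) (≡⇒≤ 2 p e)
    end (end-nonzero p) m = ≡⇒≤ 1 p e
  word⇒admissible (next a e sp) m w = word⇒admissible-next e sp m (uncons w) refl refl

  word⇒admissible-next {k = k} {f} e sp m (free-0 w) refl refl = admissible-cons
    (≡⇒≤ 0 z≤n e)
    (subst (1ℤ ≤_) (sym (trans (cong (_+ f 1) e) (ℤ.+-identityˡ (f 1)))) (proj₁ (lead A)))
    (subst (+ 2 ≤_) (sym (trans (cong (λ x → x + f 1 + f 2) e) (cong (_+ f 2) (ℤ.+-identityˡ (f 1))))) (proj₂ (lead A)))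
    tt A
    where A = word⇒admissible sp (mirror-suc f m (λ _ → e)) w
  word⇒admissible-next {f = f} {M} e sp m (free-1+ {M = M′} a w) refl e′ with ℕ.+-cancelˡ-≡ (suc a) M′ M e′
  ... | refl = admissible-cons-≥1 f m (≡⇒≤ 1 (s≤s z≤n) e) tt (word⇒admissible sp (mirror-suc f m (λ ())) w)
  word⇒admissible-next {f = f} e sp m (blocked-1 w) refl refl = admissible-cons-≥1 f m (≡⇒≤ 1 (s≤s z≤n) e)
    (≡⇒≤ 1 (s≤s z≤n) e , ℤ.+-mono-≤ {1ℤ} {f 0} {1ℤ} (≡⇒≤ 1 (s≤s z≤n) e) (lead A)) A
    where A = word⇒admissible sp (mirror-suc f m (λ ())) w
  word⇒admissible-next {f = f} {M} e sp m (blocked-2+ {M = M′} a w) refl e′ with ℕ.+-cancelˡ-≡ (suc (suc a)) M′ M e′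
  ... | refl = admissible-cons-≥1 f m (≡⇒≤ 1 (s≤s z≤n) e)
    (≡⇒≤ 1 (s≤s z≤n) e , ℤ.+-mono-≤ {+ 2} {f 0} {0ℤ} (≡⇒≤ 2 (s≤s (s≤s z≤n)) e) (single A z≤n)) A
    where A = word⇒admissible sp (mirror-suc f m (λ ())) w
  word⇒admissible-next {f = f} {M} e sp m (nonzero-1+ {M = M′} a w) refl e′ with ℕ.+-cancelˡ-≡ (suc a) M′ M e′
  ... | refl = admissible-cons-≥1 f m (≡⇒≤ 1 (s≤s z≤n) e) (≡⇒≤ 1 (s≤s z≤n) e)
    (word⇒admissible sp (mirror-suc f m (λ ())) w)

  Falls : (ℕ → ℤ) → ℕ → (ℕ → ℤ) → Set
  Falls f k h = ∀ {i} → i ℕ.< k → f i ≡ h i - h (suc i) + 1ℤ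

  spells-walk : ∀ {ε f k M l h} → Spells ε f k M l → Falls f k h → ∀ {i} → i ℕ.≤ k → walk (h 0) l i ≡ h i
  spells-walk sp fh {zero} _ = refl
  spells-walk {h = h} (next {l = l} a e sp) fh {suc i} (s≤s i≤k) = trans
    (cong (λ z → walk z l i) (≡-by (trans (sym (fh (s≤s z≤n))) e)
      (solve 3 (λ x y a → x :- y :+ con 1ℤ :- a := x :+ con 1ℤ :- a :- y) refl (h 0) (h 1) (+ a))))
    (spells-walk {h = h ∘ suc} sp (fh ∘ s≤s) i≤k)

  -- Since ε is at most 1, i = -1 would already make the central letter negative.
  double-nonneg : ∀ {ε} i → ε ℕ.≤ 1 → 0ℤ ≤ i + i + + ε → ∃[ n ] i ≡ + n
  double-nonneg (+ n)    _         _ = n , refl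
  double-nonneg -[1+ n ] z≤n       ()
  double-nonneg -[1+ n ] (s≤s z≤n) ()

  -- κ is chosen such that h k + κ is the remainder left for the last letter.
  spells-exists : ∀ {ε} κ f k h → ε ℕ.≤ 1 → (∀ {i} → i ℕ.≤ k → 0ℤ ≤ f i) → Falls f k h →
    f k ≡ h k + κ + (h k + κ) + + ε → ∃[ M ] ∃[ l ] Spells ε f k M l × + M ≡ h 0 + κ + + k
  spells-exists κ f zero h ε≤1 0≤f fh e with double-nonneg (h 0 + κ) ε≤1 (subst (0ℤ ≤_) e (0≤f z≤n))
  ... | M , eM = M , [] , last (trans e (cong (λ x → x + x + _) eM)) , sym (trans (ℤ.+-identityʳ _) eM)
  spells-exists κ f (suc k) h ε≤1 0≤f fh e with spells-exists κ (f ∘ suc) k (h ∘ suc) ε≤1 (0≤f ∘ s≤s) (fh ∘ s≤s) e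
  ... | M , l , sp , eM with f 0 in f0 | 0≤f z≤n
  ... | + a | _ = a ℕ.+ M , a ∷ l , next a f0 sp , ≡-by (cong₂ _+_ (trans (sym f0) (fh (s≤s z≤n))) eM)
    (solve 6 (λ a M x y κ k → a :+ M :- (x :- y :+ con 1ℤ :+ (y :+ κ :+ k)) := a :+ M :- (x :+ κ :+ (con 1ℤ :+ k)))
      refl (+ a) (+ M) (h 0) (h 1) κ (+ k))

  word⇒spells : ∀ {ε σ} κ f k z {M l} → Word ε σ k M l → Falls f k (walk z l) →
    f k ≡ walk z l k + κ + (walk z l k + κ) + + ε → + M ≡ z + κ + + k → Spells ε f k M l
  word⇒spells-next : ∀ {ε σ k M l} κ f z → Uncons ε σ (suc k) M l → Falls f (suc k) (walk z l) →
    f (suc k) ≡ walk z l (suc k) + κ + (walk z l (suc k) + κ) + + ε → + M ≡ z + κ + + suc k → Spells ε f (suc k) M l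

  word⇒spells {ε} κ f zero z {M} {[]} w fh e eM =
    last (trans e (cong (λ x → x + x + + ε) (sym (trans eM (ℤ.+-identityʳ (z + κ))))))
  word⇒spells κ f zero z {l = _ ∷ _} () 
  word⇒spells κ f (suc k) z w fh e eM = word⇒spells-next κ f z (uncons w) fh e eM

  word⇒spells-next {ε} {k = k} κ f z u fh e eM = go u fh e eM
    where
    step : ∀ {σ l M} a → Word ε σ k M l → Falls f (suc k) (walk z (a ∷ l)) →
      f (suc k) ≡ walk z (a ∷ l) (suc k) + κ + (walk z (a ∷ l) (suc k) + κ) + + ε →
      + (a ℕ.+ M) ≡ z + κ + + suc k → Spells ε f (suc k) (a ℕ.+ M) (a ∷ l)
    step {M = M} a w fh e eM = next a
      (trans (fh (s≤s z≤n)) (solve 2 (λ z a → z :- (z :+ con 1ℤ :- a) :+ con 1ℤ := a) refl z (+ a)))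
      (word⇒spells κ (f ∘ suc) k (z + 1ℤ - + a) w (fh ∘ s≤s) e (≡-by eM
        (solve 5 (λ a M z κ k → a :+ M :- (z :+ κ :+ (con 1ℤ :+ k)) := M :- (z :+ con 1ℤ :- a :+ κ :+ k)) refl (+ a) (+ M) z κ (+ k))))
    go : ∀ {σ M l} → Uncons ε σ (suc k) M l → Falls f (suc k) (walk z l) →
      f (suc k) ≡ walk z l (suc k) + κ + (walk z l (suc k) + κ) + + ε → + M ≡ z + κ + + suc k → Spells ε f (suc k) M l
    go (free-0 w)       = step 0 w
    go (free-1+ a w)    = step (suc a) w
    go (blocked-1 w)    = step 1 w
    go (blocked-2+ a w) = step (suc (suc a)) w
    go (nonzero-1+ a w) = step (suc a) w

  -- Folding a profile along its symmetries

  half-≤ : ∀ {i μ} → i ℕ.+ i ℕ.≤ suc (μ ℕ.+ μ) → i ℕ.≤ μ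
  half-≤ {i} {μ} p = ℕ.≮⇒≥ λ μ<i → ℕ.<-irrefl refl (ℕ.≤-trans
    (ℕ.≤-reflexive (cong suc (sym (ℕ.+-suc μ μ)))) (ℕ.≤-trans (ℕ.+-mono-≤ μ<i μ<i) p))

  quotient-≤ : ∀ {s r r′} {q q′ : ℤ} → r ℕ.< s → + r + q * + s ≡ + r′ + q′ * + s → q′ ≤ q
  quotient-≤ {s} {r} {r′} {q} {q′} r<s e = ℤ.≮⇒≥ λ q<q′ → ℤ.<-irrefl e (ℤ.<-≤-trans
    (ℤ.+-monoˡ-< (q * + s) (+<+ r<s))
    (ℤ.≤-trans (subst (_≤ q′ * + s) (solve 2 (λ q s → (q :+ con 1ℤ) :* s := s :+ q :* s) refl q (+ s))
        (ℤ.*-monoʳ-≤-nonNeg (+ s) (<⇒+1≤ q<q′)))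
      (ℤ.i≤j+i (q′ * + s) (+ r′))))

  divMod-unique : ∀ {s r r′} {q q′ : ℤ} → r ℕ.< s → r′ ℕ.< s → + r + q * + s ≡ + r′ + q′ * + s → r ≡ r′ × q ≡ q′
  divMod-unique {s} {r} {r′} {q} {q′} r<s r′<s e = ℤ.+-injective r≡r′ , q≡q′
    where
    q≡q′ : q ≡ q′
    q≡q′ = ℤ.≤-antisym (quotient-≤ r′<s (sym e)) (quotient-≤ r<s e)
    r≡r′ : + r ≡ + r′
    r≡r′ = ≡-by (trans e (cong (λ q → + r′ + q * + s) (sym q≡q′)))
      (solve 3 (λ r r′ x → r :+ x :- (r′ :+ x) := r :- r′) refl (+ r) (+ r′) (q * + s))

  SelfConjugateCore : ℕ → ℕ → Partition → Set
  SelfConjugateCore s d p = SelfConjugate p × IsSimultaneousCore (s ∷ s ℕ.+ d ∷ s ℕ.+ 2 ℕ.* d ∷ s ℕ.+ 3 ℕ.* d ∷ []) p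

  -- The symmetries of a profile are generated by the reflections j ↦ α - j and j ↦ 2 μ + 1 - j.
  -- The latter fixes the letter at μ, which is 2 (h μ + κ) + ε.
  module Folded (s d : ℕ) .{{s≢0 : NonZero s}} (u v α β c : ℤ)
    (bezout : u * + d + v * + s ≡ 1ℤ) (centre : c + c + (α * + d + β * + s) ≡ 1ℤ)
    (μ ε : ℕ) (κ : ℤ) (axis : α + + s ≡ + suc (μ ℕ.+ μ))
    (s≥ : suc (μ ℕ.+ μ) ℕ.≤ s) (s≤ : s ℕ.≤ suc (suc (μ ℕ.+ μ)))
    (ε≤1 : ε ℕ.≤ 1) (level : κ + κ + + ε ≡ + d + + 2 - β) where

    open Grid s d u v α β c bezout centre public

    private
      N : ℕ
      N = suc (μ ℕ.+ μ)

      N∸r≤μ : ∀ {r} → μ ℕ.< r → N ℕ.∸ r ℕ.≤ μ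
      N∸r≤μ {r} μ<r = subst (N ℕ.∸ r ℕ.≤_) (ℕ.m+n∸m≡n μ μ) (ℕ.∸-monoʳ-≤ N μ<r)

      μ<N∸r : ∀ {r} → r ℕ.≤ μ → μ ℕ.< N ℕ.∸ r
      μ<N∸r {r} r≤μ = subst (ℕ._≤ N ℕ.∸ r) (ℕ.m+n∸n≡m (suc μ) μ) (ℕ.∸-monoʳ-≤ N r≤μ)

    -1≤α : - 1ℤ ≤ α
    -1≤α = ≤-by (+≤+ s≤) (≡-by (sym axis)
      (solve 3 (λ m α s → con 1ℤ :+ m :- (α :+ s) := con (+ 2) :+ m :- s :- (α :- :- con 1ℤ)) refl (+ (μ ℕ.+ μ)) α (+ s)))

    -- The step from j to j + k is governed by 2 j + k. Translation by s adds 2 s to this number,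
    -- and reflection turns it into 2 α - (2 j + k). A fundamental domain is the interval from α to
    -- α + s = `N`.
    climb-fold : ∀ {h} → Profile h → ∀ k →
      (∀ j → α ≤ j + j + k → j + j + k ≤ + N → h (j + k) ≤ h j + 1ℤ) → Climb h k
    climb-fold {h} P k local j =
      subst₂ (λ x y → h x ≤ h y + 1ℤ)
        (solve 3 (λ j k m → j :- m :+ k :+ m := j :+ k) refl j k (q * + s))
        (solve 2 (λ j m → j :- m :+ m := j) refl j (q * + s))
        (subst₂ (λ x y → x ≤ y + 1ℤ) (sym (quasiperiodic (j′ + k) q)) (sym (quasiperiodic j′ q))
          (≤-by near (solve 3 (λ x y m → y :+ con 1ℤ :- x := y :- m :+ con 1ℤ :- (x :- m)) refl (h (j′ + k)) (h j′) (q * + d))))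
      where
      open Profile P
      instance
        2s≢0 : NonZero (s ℕ.+ s)
        2s≢0 = ℕ.>-nonZero (ℕ.≤-trans (ℕ.>-nonZero⁻¹ s) (ℕ.m≤m+n s s))
      t : ℤ
      t = j + j + k - α + + s
      r : ℕ
      r = t %ℕ (s ℕ.+ s)
      q j′ : ℤ
      q = t /ℕ (s ℕ.+ s)
      j′ = j - q * + s
      r<2s : + r ≤ + s + + s
      r<2s = +≤+ (ℕ.<⇒≤ (n%ℕd<d t (s ℕ.+ s)))
      offset : j′ + j′ + k ≡ + r - + s + α
      offset = ≡-by (a≡a%ℕn+[a/ℕn]*n t (s ℕ.+ s))
        (solve 6 (λ j k α s q r → j :+ j :+ k :- α :+ s :- (r :+ q :* (s :+ s))
            := j :- q :* s :+ (j :- q :* s) :+ k :- (r :- s :+ α)) refl j k α (+ s) q (+ r))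
      near : h (j′ + k) ≤ h j′ + 1ℤ
      -- If r ≥ s, the translated step lies in the interval; otherwise its reflection does.
      near with s ℕ.≤? r
      ... | yes s≤r = local j′
        (≤-by (+≤+ s≤r) (trans (solve 3 (λ r s α → r :- s := r :- s :+ α :- α) refl (+ r) (+ s) α) (cong (_- α) (sym offset))))
        (≤-by r<2s (trans (≡-by axis (solve 4 (λ s r α N → α :+ s :- N := s :+ s :- r :- (N :- (r :- s :+ α))) refl (+ s) (+ r) α (+ N)))
          (cong (λ x → + N - x) (sym offset))))
      ... | no s≰r = ≤-by mirrored (≡-by (cong₂ _-_ (antisymmetric (j′ + k)) (antisymmetric j′))
          (solve 5 (λ x x′ y y′ b → x :+ x′ :- (y :+ y′) :- (b :- b) := x′ :+ con 1ℤ :- y′ :- (y :+ con 1ℤ :- x)) refl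
            (h (j′ + k)) (h (α - (j′ + k))) (h j′) (h (α - j′)) (β - 1ℤ)))
        where
        j″ : ℤ
        j″ = α - (j′ + k)
        offset″ : j″ + j″ + k ≡ α + + s - + r
        offset″ = ≡-by (sym offset) (solve 5 (λ j k α s r → r :- s :+ α :- (j :+ j :+ k)
            := α :- (j :+ k) :+ (α :- (j :+ k)) :+ k :- (α :+ s :- r)) refl j′ k α (+ s) (+ r))
        mirrored : h (α - j′) ≤ h j″ + 1ℤ
        mirrored = subst (λ x → h x ≤ h j″ + 1ℤ) (solve 3 (λ j k α → α :- (j :+ k) :+ k := α :- j) refl j′ k α)
          (local j″
            (≤-by (+≤+ (ℕ.<⇒≤ (ℕ.≰⇒> s≰r))) (trans (solve 3 (λ s r α → s :- r := α :+ s :- r :- α) refl (+ s) (+ r) α)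
               (cong (_- α) (sym offset″))))
            (≤-by (+≤+ (z≤n {r})) (trans (≡-by axis (solve 4 (λ s r α N → α :+ s :- N := r :- con 0ℤ :- (N :- (α :+ s :- r))) refl
               (+ s) (+ r) α (+ N))) (cong (λ x → + N - x) (sym offset″)))))

    fall : (ℤ → ℤ) → ℤ → ℤ
    fall h j = h j - h (1ℤ + j) + 1ℤ

    module _ {h : ℤ → ℤ} (P : Profile h) where
      open Profile P

      fall-mirrorˡ : ∀ j → fall h (α - 1ℤ - j) ≡ fall h j
      fall-mirrorˡ j = ≡-by (trans e₁ (sym e₂))
        (solve 4 (λ x y a b → y :+ a :- (x :+ b) := a :- b :+ con 1ℤ :- (x :- y :+ con 1ℤ)) refl
          (h j) (h (1ℤ + j)) (h (α - 1ℤ - j)) (h (1ℤ + (α - 1ℤ - j))))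
        where
        e₁ : h (1ℤ + j) + h (α - 1ℤ - j) ≡ β - 1ℤ
        e₁ = trans (cong (λ i → h (1ℤ + j) + h i) (solve 2 (λ a j → a :- con 1ℤ :- j := a :- (con 1ℤ :+ j)) refl α j))
          (antisymmetric (1ℤ + j))
        e₂ : h j + h (1ℤ + (α - 1ℤ - j)) ≡ β - 1ℤ
        e₂ = trans (cong (λ i → h j + h i) (solve 2 (λ a j → con 1ℤ :+ (a :- con 1ℤ :- j) := a :- j) refl α j))
          (antisymmetric j)

      fall-wrap : ∀ j → fall h (j + + s) ≡ fall h j
      fall-wrap j = ≡-by (cong₂ _-_ e₁ e₂)
        (solve 5 (λ a b x y d → a :- b :- (x :- d :- (y :- d)) := a :- b :+ con 1ℤ :- (x :- y :+ con 1ℤ)) refl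
          (h (j + + s)) (h (1ℤ + (j + + s))) (h j) (h (1ℤ + j)) (1ℤ * + d))
        where
        e₁ : h (j + + s) ≡ h j - 1ℤ * + d
        e₁ = trans (cong h (solve 2 (λ j s → j :+ s := j :+ con 1ℤ :* s) refl j (+ s))) (quasiperiodic j 1ℤ)
        e₂ : h (1ℤ + (j + + s)) ≡ h (1ℤ + j) - 1ℤ * + d
        e₂ = trans (cong h (solve 2 (λ j s → con 1ℤ :+ (j :+ s) := con 1ℤ :+ j :+ con 1ℤ :* s) refl j (+ s)))
          (quasiperiodic (1ℤ + j) 1ℤ)

      fall-mirrorʳ : ∀ j → fall h (+ (μ ℕ.+ μ) - j) ≡ fall h j
      fall-mirrorʳ j = trans (cong (fall h) (≡-by (sym axis)
          (solve 4 (λ m j α s → con 1ℤ :+ m :- (α :+ s) := m :- j :- (α :- con 1ℤ :- j :+ s)) refl (+ (μ ℕ.+ μ)) j α (+ s))))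
        (trans (fall-wrap (α - 1ℤ - j)) (fall-mirrorˡ j))

      -- Translation and reflection give h(μ + 1) = h(α - μ) - d = β - 1 - d - h(μ). So the letter
      -- is 2 h(μ) + d + 2 - β, which `level` splits into an even part and ε.
      fall-axis : fall h (+ μ) ≡ h (+ μ) + κ + (h (+ μ) + κ) + + ε
      fall-axis = ≡-by (cong₂ _+_ (cong₂ _+_ (sym e) (sym (antisymmetric (+ μ)))) (sym level))
        (solve 7 (λ x y w κ ε d β → w :- con 1ℤ :* d :+ (β :- con 1ℤ) :+ (d :+ con (+ 2) :- β) :- (y :+ (x :+ w) :+ (κ :+ κ :+ ε))
            := x :- y :+ con 1ℤ :- (x :+ κ :+ (x :+ κ) :+ ε)) refl
          (h (+ μ)) (h (1ℤ + + μ)) (h (α - + μ)) κ (+ ε) (+ d) β)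
        where
        e : h (1ℤ + + μ) ≡ h (α - + μ) - 1ℤ * + d
        e = trans (cong h (≡-by (sym axis) (solve 3 (λ m α s → con 1ℤ :+ (m :+ m) :- (α :+ s)
              := con 1ℤ :+ m :- (α :- m :+ con 1ℤ :* s)) refl (+ μ) α (+ s))))
          (quasiperiodic (α - + μ) 1ℤ)

      gaps : ℕ → ℤ
      gaps i = fall h (+ i)

      gaps-falls : ∀ k → Falls gaps k (h ∘ +_)
      gaps-falls k _ = refl

      climb₁⇒ : Climb h 1ℤ → ∀ j → 0ℤ ≤ fall h j
      climb₁⇒ cl j = ≤-by (subst (λ i → h i ≤ h j + 1ℤ) (ℤ.+-comm j 1ℤ) (cl j))
        (solve 2 (λ x y → x :+ con 1ℤ :- y := x :- y :+ con 1ℤ :- con 0ℤ) refl (h j) (h (1ℤ + j)))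

      climb₂⇒ : Climb h (+ 2) → ∀ j → 1ℤ ≤ fall h j + fall h (1ℤ + j)
      climb₂⇒ cl j = ≤-by (subst (λ i → h i ≤ h j + 1ℤ) (solve 1 (λ j → j :+ con (+ 2) := con 1ℤ :+ (con 1ℤ :+ j)) refl j) (cl j))
        (solve 3 (λ x y z → x :+ con 1ℤ :- z := x :- y :+ con 1ℤ :+ (y :- z :+ con 1ℤ) :- con 1ℤ) refl
          (h j) (h (1ℤ + j)) (h (1ℤ + (1ℤ + j))))

      climb₃⇒ : Climb h (+ 3) → ∀ j → + 2 ≤ fall h j + fall h (1ℤ + j) + fall h (1ℤ + (1ℤ + j))
      climb₃⇒ cl j = ≤-by (subst (λ i → h i ≤ h j + 1ℤ)
          (solve 1 (λ j → j :+ con (+ 3) := con 1ℤ :+ (con 1ℤ :+ (con 1ℤ :+ j))) refl j) (cl j))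
        (solve 4 (λ x y z w → x :+ con 1ℤ :- w := x :- y :+ con 1ℤ :+ (y :- z :+ con 1ℤ) :+ (z :- w :+ con 1ℤ) :- con (+ 2)) refl
          (h j) (h (1ℤ + j)) (h (1ℤ + (1ℤ + j))) (h (1ℤ + (1ℤ + (1ℤ + j)))))

      climb₁⇐ : ∀ j → 0ℤ ≤ fall h j → h (j + 1ℤ) ≤ h j + 1ℤ
      climb₁⇐ j p = subst (λ i → h i ≤ h j + 1ℤ) (ℤ.+-comm 1ℤ j) (≤-by p
        (solve 2 (λ x y → x :- y :+ con 1ℤ :- con 0ℤ := x :+ con 1ℤ :- y) refl (h j) (h (1ℤ + j))))

      climb₂⇐ : ∀ j → 1ℤ ≤ fall h j + fall h (1ℤ + j) → h (j + + 2) ≤ h j + 1ℤ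
      climb₂⇐ j p = subst (λ i → h i ≤ h j + 1ℤ) (solve 1 (λ j → con 1ℤ :+ (con 1ℤ :+ j) := j :+ con (+ 2)) refl j) (≤-by p
        (solve 3 (λ x y z → x :- y :+ con 1ℤ :+ (y :- z :+ con 1ℤ) :- con 1ℤ := x :+ con 1ℤ :- z) refl
          (h j) (h (1ℤ + j)) (h (1ℤ + (1ℤ + j)))))

      climb₃⇐ : ∀ j → + 2 ≤ fall h j + fall h (1ℤ + j) + fall h (1ℤ + (1ℤ + j)) → h (j + + 3) ≤ h j + 1ℤ
      climb₃⇐ j p = subst (λ i → h i ≤ h j + 1ℤ)
          (solve 1 (λ j → con 1ℤ :+ (con 1ℤ :+ (con 1ℤ :+ j)) := j :+ con (+ 3)) refl j) (≤-by p
        (solve 4 (λ x y z w → x :- y :+ con 1ℤ :+ (y :- z :+ con 1ℤ) :+ (z :- w :+ con 1ℤ) :- con (+ 2) := x :+ con 1ℤ :- w) refl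
          (h j) (h (1ℤ + j)) (h (1ℤ + (1ℤ + j))) (h (1ℤ + (1ℤ + (1ℤ + j))))))

      Climbs : Set
      Climbs = Climb h 1ℤ × Climb h (+ 2) × Climb h (+ 3)

      climbs⇒admissible : ∀ {σ} → Climbs → Lead σ gaps → Admissible σ μ gaps
      climbs⇒admissible (c₁ , c₂ , c₃) l = record
        { single = λ {i} _ → climb₁⇒ c₁ (+ i)
        ; double = λ {i} _ → climb₂⇒ c₂ (+ i)
        ; triple = λ {i} _ → climb₃⇒ c₃ (+ i)
        ; lead   = l
        }

      -- The constraints on letters left of position 0.
      Margin : Set
      Margin = 0ℤ ≤ fall h (- + 1) × 1ℤ ≤ fall h (- + 1) + fall h 0ℤ
             × + 2 ≤ fall h (- + 1) + fall h 0ℤ + fall h 1ℤ × + 2 ≤ fall h (- + 2) + fall h (- + 1) + fall h 0ℤ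

      below-α : ∀ {j} m k → j ≤ - + m → - + m + - + m + + k ≤ - + 2 → ¬ (α ≤ j + j + + k)
      below-α {j} m k j≤ le α≤ with ℤ.≤-trans -1≤α (ℤ.≤-trans α≤ (ℤ.≤-trans (ℤ.+-monoˡ-≤ (+ k) (ℤ.+-mono-≤ j≤ j≤)) le))
      ... | -≤- ()

      -- After folding, a step of width k from a negative j satisfies 2 j + k ≥ α ≥ -1. For k ≤ 3
      -- this leaves j = -1, and j = -2 with k = 3: the four conditions of `Margin`.
      margin⇒climbs : ∀ {σ} → Admissible σ μ gaps → Margin → Climbs
      margin⇒climbs A (m₁ , m₂ , m₃ , m₄) =
          climb-fold P 1ℤ c₁ , climb-fold P (+ 2) c₂ , climb-fold P (+ 3) c₃
        where
        c₁ : ∀ j → α ≤ j + j + 1ℤ → j + j + 1ℤ ≤ + N → h (j + 1ℤ) ≤ h j + 1ℤ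
        c₁ (+ i) _ le = climb₁⇐ (+ i) (single A (half-≤ (ℕ.≤-trans (ℕ.m≤m+n (i ℕ.+ i) 1) (ℤ.drop‿+≤+ le))))
        c₁ -[1+ zero ]  _ _ = climb₁⇐ -[1+ 0 ] m₁
        c₁ -[1+ suc n ] α≤ _ = ⊥-elim (below-α 2 1 (-≤- (s≤s z≤n)) (-≤- (s≤s z≤n)) α≤)
        c₂ : ∀ j → α ≤ j + j + + 2 → j + j + + 2 ≤ + N → h (j + + 2) ≤ h j + 1ℤ
        c₂ (+ i) _ le = climb₂⇐ (+ i) (double A (half-≤ (ℕ.≤-trans (ℕ.≤-reflexive (trans (cong suc (ℕ.+-suc i i)) (ℕ.+-comm 2 (i ℕ.+ i)))) (ℤ.drop‿+≤+ le))))
        c₂ -[1+ zero ]  _ _ = climb₂⇐ -[1+ 0 ] m₂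
        c₂ -[1+ suc n ] α≤ _ = ⊥-elim (below-α 2 2 (-≤- (s≤s z≤n)) (-≤- (s≤s z≤n)) α≤)
        c₃ : ∀ j → α ≤ j + j + + 3 → j + j + + 3 ≤ + N → h (j + + 3) ≤ h j + 1ℤ
        c₃ (+ i) _ le = climb₃⇐ (+ i) (triple A (half-≤ (ℕ.≤-trans (ℕ.≤-reflexive (trans (cong suc (ℕ.+-suc i i)) (ℕ.+-comm 2 (i ℕ.+ i))))
          (ℕ.≤-trans (ℕ.+-monoʳ-≤ (i ℕ.+ i) (s≤s (s≤s z≤n))) (ℤ.drop‿+≤+ le)))))
        c₃ -[1+ zero ]  _ _ = climb₃⇐ -[1+ 0 ] m₃
        c₃ -[1+ suc zero ]  _ _ = climb₃⇐ -[1+ 1 ] m₄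
        c₃ -[1+ suc (suc n) ] α≤ _ = ⊥-elim (below-α 3 3 (-≤- (s≤s (s≤s z≤n))) (-≤- (s≤s z≤n)) α≤)

      mirror-gaps : ∀ {σ} → (σ ≡ blocked → fall h (- + 1) ≡ 0ℤ) → Mirror σ μ gaps
      mirror-gaps {σ} z = go μ refl
        where
        go : ∀ k → k ≡ μ → Mirror σ k gaps
        go zero    refl b = trans (fall-mirrorʳ (- + 1)) (z b)
        go (suc k) refl   = trans (cong (fall h) (solve 1 (λ k → con (+ 2) :+ k := con 1ℤ :+ (k :+ (con 1ℤ :+ k)) :- k) refl (+ k)))
          (fall-mirrorʳ (+ k))

      -- If μ = 0, position 1 lies beyond the centre and mirrors position -1.
      gap₁-nonneg : ∀ {σ} → Admissible σ μ gaps → 0ℤ ≤ fall h (- + 1) → 0ℤ ≤ fall h 1ℤ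
      gap₁-nonneg {σ} A 0≤ = go μ refl A
        where
        go : ∀ k → k ≡ μ → Admissible σ k gaps → 0ℤ ≤ fall h 1ℤ
        go zero    refl A = subst (0ℤ ≤_) (sym (fall-mirrorʳ (- + 1))) 0≤
        go (suc k) _    A = single A (s≤s z≤n)

    -- Reflection determines the columns up to `N` from those up to μ. As s ≤ N + 1, these contain a
    -- full period.
    profile-unique : ∀ {h h′} → Profile h → Profile h′ → (∀ {r} → r ℕ.≤ μ → h (+ r) ≡ h′ (+ r)) → ∀ j → h j ≡ h′ j
    profile-unique {h} {h′} P P′ agree j = subst (λ j → h j ≡ h′ j) (sym (a≡a%ℕn+[a/ℕn]*n j s))
      (trans (Profile.quasiperiodic P (+ r) q) (trans (cong (_- q * + d) agree-r) (sym (Profile.quasiperiodic P′ (+ r) q))))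
      where
      r = j %ℕ s
      q = j /ℕ s
      reflected : ∀ {h} → Profile h → h (+ r) ≡ β - 1ℤ - + d - h (+ N - + r)
      reflected {h} P = ≡-by (cong₂ _-_ (antisymmetric (+ r)) (sym wrap))
        (solve 5 (λ x x′ y b d → x :+ x′ :- (x′ :- con 1ℤ :* d) :- (b :- y) := x :- (b :- d :- y)) refl (h (+ r)) (h (α - + r)) (h (+ N - + r)) (β - 1ℤ) (+ d))
        where
        open Profile P
        wrap : h (+ N - + r) ≡ h (α - + r) - 1ℤ * + d
        wrap = trans (cong h (≡-by (sym axis) (solve 4 (λ N r α s → N :- (α :+ s) := N :- r :- (α :- r :+ con 1ℤ :* s)) refl (+ N) (+ r) α (+ s))))
          (quasiperiodic (α - + r) 1ℤ)
      agree-r : h (+ r) ≡ h′ (+ r)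
      agree-r with r ℕ.≤? μ
      ... | yes r≤μ = agree r≤μ
      ... | no  r≰μ = trans (reflected P) (trans (cong (λ x → β - 1ℤ - + d - x) agree′) (sym (reflected P′)))
        where
        r≤N : r ℕ.≤ N
        r≤N = ℕ.≤-pred (ℕ.≤-trans (n%ℕd<d j s) s≤)
        N-r : + N - + r ≡ + (N ℕ.∸ r)
        N-r = trans (ℤ.m-n≡m⊖n N r) (ℤ.⊖-≥ r≤N)
        agree′ : h (+ N - + r) ≡ h′ (+ N - + r)
        agree′ = subst (λ j → h j ≡ h′ j) (sym N-r) (agree (N∸r≤μ (ℕ.≰⇒> r≰μ)))

    module _ (z : ℤ) (l : List ℕ) where

      -- The second clause is forced: column N - r is α - r one period later, whence the constant β
      -- - 1 - d.
      half : ℕ → ℤ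
      half r with r ℕ.≤? μ
      ... | yes _ = walk z l r
      ... | no  _ = β - 1ℤ - + d - walk z l (N ℕ.∸ r)

      half-low : ∀ {r} → r ℕ.≤ μ → half r ≡ walk z l r
      half-low {r} r≤μ with r ℕ.≤? μ
      ... | yes _   = refl
      ... | no  r≰μ = ⊥-elim (r≰μ r≤μ)

      half-high : ∀ {r} → μ ℕ.< r → half r ≡ β - 1ℤ - + d - walk z l (N ℕ.∸ r)
      half-high {r} μ<r with r ℕ.≤? μ
      ... | yes r≤μ = ⊥-elim (ℕ.<⇒≱ μ<r r≤μ)
      ... | no  _   = refl

      half-complement : ∀ {r} → r ℕ.≤ N → half r + half (N ℕ.∸ r) ≡ β - 1ℤ - + d
      half-complement {r} r≤N with ℕ.≤-<-connex r μ
      ... | inj₁ r≤μ = trans (cong₂ _+_ (half-low r≤μ)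
          (trans (half-high (μ<N∸r r≤μ)) (cong (λ i → β - 1ℤ - + d - walk z l i) (ℕ.m∸[m∸n]≡n r≤N))))
        (solve 2 (λ x b → x :+ (b :- x) := b) refl (walk z l r) (β - 1ℤ - + d))
      ... | inj₂ μ<r = trans (cong₂ _+_ (half-high μ<r) (half-low (N∸r≤μ μ<r)))
        (solve 2 (λ x b → b :- x :+ x := b) refl (walk z l (N ℕ.∸ r)) (β - 1ℤ - + d))

      extend : ℤ → ℤ
      extend j = half (j %ℕ s) - (j /ℕ s) * + d

      -- If s = N, then reflection fixes column 0.
      Edge : Set
      Edge = s ≡ N → z + z ≡ β - 1ℤ

      extend-<s : ∀ {r} → r ℕ.< s → ∀ q → extend (+ r + q * + s) ≡ half r - q * + d
      extend-<s {r} r<s q with divMod-unique {s} {q = (+ r + q * + s) /ℕ s} {q′ = q} (n%ℕd<d (+ r + q * + s) s) r<s (sym (a≡a%ℕn+[a/ℕn]*n (+ r + q * + s) s))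
      ... | e₁ , e₂ = cong₂ (λ r q → half r - q * + d) e₁ e₂

      module _ (edge : Edge) where

        -- If s = `N`, the column `N` is column 0 one period later and so has two descriptions.
        -- `edge` makes them agree.
        extend-≤N : ∀ {r} → r ℕ.≤ N → ∀ q → extend (+ r + q * + s) ≡ half r - q * + d
        extend-≤N {r} r≤N q with r ℕ.<? s
        ... | yes r<s = extend-<s r<s q
        ... | no  r≮s = begin
          extend (+ r + q * + s)
            ≡⟨ cong (λ r → extend (+ r + q * + s)) r≡s ⟩
          extend (+ s + q * + s)
            ≡⟨ cong extend (solve 2 (λ s q → s :+ q :* s := con 0ℤ :+ (q :+ con 1ℤ) :* s) refl (+ s) q) ⟩
          extend (+ 0 + (q + 1ℤ) * + s)
            ≡⟨ extend-<s (ℕ.>-nonZero⁻¹ s) (q + 1ℤ) ⟩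
          half 0 - (q + 1ℤ) * + d
            ≡⟨ cong (λ x → x - (q + 1ℤ) * + d) (half-low z≤n) ⟩
          z - (q + 1ℤ) * + d
            ≡⟨ ≡-by (edge s≡N) (solve 4 (λ z b q d → z :+ z :- b := z :- (q :+ con 1ℤ) :* d :- (b :- d :- z :- q :* d)) refl z (β - 1ℤ) q (+ d)) ⟩
          β - 1ℤ - + d - z - q * + d
            ≡⟨ cong (λ i → β - 1ℤ - + d - walk z l i - q * + d) (ℕ.n∸n≡0 N) ⟨
          β - 1ℤ - + d - walk z l (N ℕ.∸ N) - q * + d
            ≡⟨ cong (λ x → x - q * + d) (half-high (s≤s (ℕ.m≤m+n μ μ))) ⟨
          half N - q * + d
            ≡⟨ cong (λ r → half r - q * + d) (trans r≡s s≡N) ⟨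
          half r - q * + d ∎
          where
          open ≡-Reasoning
          r≡s : r ≡ s
          r≡s = ℕ.≤-antisym (ℕ.≤-trans r≤N s≥) (ℕ.≮⇒≥ r≮s)
          s≡N : s ≡ N
          s≡N = ℕ.≤-antisym (ℕ.≤-trans (ℕ.≮⇒≥ r≮s) r≤N) s≥

        extend-walk : ∀ {r} → r ℕ.≤ μ → extend (+ r) ≡ walk z l r
        extend-walk {r} r≤μ = trans (cong extend (solve 2 (λ r s → r := r :+ con 0ℤ :* s) refl (+ r) (+ s)))
          (trans (extend-≤N (ℕ.m≤n⇒m≤1+n (ℕ.≤-trans r≤μ (ℕ.m≤m+n μ μ))) 0ℤ)
            (trans (solve 2 (λ x d → x :- con 0ℤ :* d := x) refl (half r) (+ d)) (half-low r≤μ)))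

        extend-profile : Profile extend
        extend-profile = record
          { quasiperiodic = λ j n → trans
              (cong extend (trans (cong (λ j → j + n * + s) (a≡a%ℕn+[a/ℕn]*n j s))
                 (solve 4 (λ r q n s → r :+ q :* s :+ n :* s := r :+ (q :+ n) :* s) refl (+ (j %ℕ s)) (j /ℕ s) n (+ s))))
              (trans (extend-<s (n%ℕd<d j s) (j /ℕ s + n))
                 (solve 4 (λ x q n d → x :- (q :+ n) :* d := x :- q :* d :- n :* d) refl (half (j %ℕ s)) (j /ℕ s) n (+ d)))
          ; antisymmetric = anti
          }
          where
          anti : ∀ j → extend j + extend (α - j) ≡ β - 1ℤ
          anti j = trans
            (cong (λ x → extend j + x) (trans (cong extend reflected) (extend-≤N (ℕ.m∸n≤m N r) (- q - 1ℤ))))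
            (≡-by (half-complement r≤N) (solve 5 (λ x y b q d → x :+ y :- (b :- d) := x :- q :* d :+ (y :- (:- q :- con 1ℤ) :* d) :- b) refl
               (half r) (half (N ℕ.∸ r)) (β - 1ℤ) q (+ d)))
            where
            r = j %ℕ s
            q = j /ℕ s
            r≤N : r ℕ.≤ N
            r≤N = ℕ.≤-pred (ℕ.≤-trans (n%ℕd<d j s) s≤)
            reflected : α - j ≡ + (N ℕ.∸ r) + (- q - 1ℤ) * + s
            reflected = ≡-by (cong₂ _+_ (sym (a≡a%ℕn+[a/ℕn]*n j s)) (trans axis (cong +_ (sym (ℕ.m+[n∸m]≡n r≤N)))))
              (solve 6 (λ r q s j α r′ → r :+ q :* s :+ (α :+ s) :- (j :+ (r :+ r′)) := α :- j :- (r′ :+ (:- q :- con 1ℤ) :* s))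
                 refl (+ r) q (+ s) j α (+ (N ℕ.∸ r)))

    -- From profiles to partitions and back

    partitionOf : (ℤ → ℤ) → Partition
    partitionOf h = fromBeadsₚ (Below? h) (bound h)

    private
      s₀ : + s ≡ + s + 0ℤ * + d
      s₀ = solve 2 (λ s d → s := s :+ con 0ℤ :* d) refl (+ s) (+ d)

      s₁ : + (s ℕ.+ d) ≡ + s + 1ℤ * + d
      s₁ = solve 2 (λ s d → s :+ d := s :+ con 1ℤ :* d) refl (+ s) (+ d)

      sₖ : ∀ k → + (s ℕ.+ k ℕ.* d) ≡ + s + + k * + d
      sₖ k = cong (λ x → + s + x) (ℤ.pos-* k d)

      closed-cong : ∀ T U {n} → (∀ x → T x ⇔ U x) → Closed T n → Closed U n
      closed-cong T U {n} e cl {x} t = to (e (x - + n)) (cl (from (e x) t))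

      below-cong : ∀ {h h′} → (∀ j → h j ≡ h′ j) → ∀ {x} → Below h x → Below h′ x
      below-cong e {x} b = subst (height x ≤_) (e (column x)) b

    partitionOf-beads : ∀ {h} (P : Profile h) → Climbs P → ∀ {x} → Beads (partitionOf h) x ⇔ Below h x
    partitionOf-beads {h} P (c₁ , _) = fromBeads-beads (Below? h) (below-symmetric P) (below-bounded P c₁)

    partitionOf-valid : ∀ {h} (P : Profile h) → Climbs P → SelfConjugateCore s d (partitionOf h)
    partitionOf-valid {h} P C@(c₁ , c₂ , c₃) = sc , core s₀ c₀ ∷ core s₁ c₁ ∷ core (sₖ 2) c₂ ∷ core (sₖ 3) c₃ ∷ []
      where
      sc : SelfConjugate (partitionOf h)
      sc = fromBeads-selfConjugate (Below? h) (bound h)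
      c₀ : Climb h 0ℤ
      c₀ j = subst (λ i → h i ≤ h j + 1ℤ) (sym (ℤ.+-identityʳ j)) (ℤ.i≤i+j (h j) 1ℤ)
      core : ∀ {k n} → + n ≡ + s + k * + d → Climb h k → IsCore n (partitionOf h)
      core {n = n} e cl = closed⇒isCore (partitionOf h) sc n
        (closed-cong (Below h) (Beads (partitionOf h))
          (λ x → mk⇔ (from (partitionOf-beads P C {x})) (to (partitionOf-beads P C {x}))) (λ {x} → climb⇒closed P e cl {x}))

    valid⇒profile : ∀ {p} → SelfConjugateCore s d p → ∃[ h ] ∃[ P ] Climbs {h} P × (∀ {x} → Beads p x ⇔ Below h x)
    valid⇒profile {p} (sc , k₀ ∷ k₁ ∷ k₂ ∷ k₃ ∷ []) = profileOf ST cl bnd , P ,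
      (climb s₁ k₁ , climb (sₖ 2) k₂ , climb (sₖ 3) k₃) , below-profileOf ST cl bnd
      where
      ST = beads-symmetric p sc
      cl = isCore⇒closed p sc s k₀
      bnd = beads-bounded p sc
      P = profileOf-profile ST cl bnd
      climb : ∀ {k n} → + n ≡ + s + k * + d → IsCore n p → Climb (profileOf ST cl bnd) k
      climb {n = n} e core = closed⇒climb P e λ {x} →
        closed-cong (Beads p) (Below (profileOf ST cl bnd)) (λ x → below-profileOf ST cl bnd {x}) (isCore⇒closed p sc n core) {x}

    partitionOf-unique : ∀ {p h h′} → (∀ {x} → Beads p x ⇔ Below h x) → (P′ : Profile h′) → Climbs P′ →
      (∀ j → h j ≡ h′ j) → p ≡ partitionOf h′
    partitionOf-unique {p} {h} {h′} B P′ C′ e = beads-injective p (partitionOf h′)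
      λ {x} → mk⇔ (λ b → from (partitionOf-beads P′ C′ {x}) (below-cong e {x} (to (B {x}) b)))
                  (λ b → from (B {x}) (below-cong (sym ∘ e) {x} (to (partitionOf-beads P′ C′ {x}) b)))

    partitionOf-injective : ∀ {h h′} (P : Profile h) (P′ : Profile h′) → Climbs P → Climbs P′ →
      partitionOf h ≡ partitionOf h′ → ∀ j → h j ≡ h′ j
    partitionOf-injective P P′ C C′ e = below-injective P P′ λ {x} → mk⇔
      (λ b → to (partitionOf-beads P′ C′) (subst (λ p → Beads p x) e (from (partitionOf-beads P C) b)))
      (λ b → to (partitionOf-beads P C) (subst (λ p → Beads p x) (sym e) (from (partitionOf-beads P′ C′) b)))

    -- A word in state σ describes the profiles with value z at 0.
    record Start (z : ℤ) (σ : State) : Set where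
      field
        edge    : ∀ l → Edge z l
        flat    : ∀ {h} → Profile h → h 0ℤ ≡ z → σ ≡ blocked → fall h (- + 1) ≡ 0ℤ
        margin  : ∀ {h} (P : Profile h) → h 0ℤ ≡ z → Admissible σ μ (gaps P) → Margin P
        leading : ∀ {h} (P : Profile h) → h 0ℤ ≡ z → Climbs P → Lead σ (gaps P)

    module _ {z σ} (S : Start z σ) where
      open Start S

      word⇒climbs : ∀ {l M} → + M ≡ z + κ + + μ → Word ε σ μ M l → Climbs (extend-profile z l (edge l))
      word⇒climbs {l} {M} eM w = margin⇒climbs P A (margin P start A)
        where
        P = extend-profile z l (edge l)
        start : extend z l 0ℤ ≡ z
        start = extend-walk z l (edge l) z≤n
        falls : Falls (gaps P) μ (walk z l)
        falls i<μ = cong₂ (λ x y → x - y + 1ℤ) (extend-walk z l (edge l) (ℕ.<⇒≤ i<μ)) (extend-walk z l (edge l) i<μ)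
        A : Admissible σ μ (gaps P)
        A = word⇒admissible
          (word⇒spells κ (gaps P) μ z w falls
            (trans (fall-axis P) (cong (λ x → x + κ + (x + κ) + + ε) (extend-walk z l (edge l) ℕ.≤-refl))) eM)
          (mirror-gaps P (flat P start)) w

      climbs⇒word : ∀ {h} (P : Profile h) → Climbs P → h 0ℤ ≡ z →
        ∃[ M ] ∃[ l ] + M ≡ z + κ + + μ × Word ε σ μ M l × (∀ j → h j ≡ extend z l j)
      climbs⇒word {h} P C refl with climbs⇒admissible P C (leading P refl C)
      ... | A with spells-exists κ (gaps P) μ (h ∘ +_) ε≤1 (single A) (gaps-falls P μ) (fall-axis P)
      ... | M , l , sp , eM = M , l , eM , admissible⇒word sp (mirror-gaps P (flat P refl)) A ,
        profile-unique P (extend-profile (h 0ℤ) l (edge l)) λ r≤μ →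
          sym (trans (extend-walk (h 0ℤ) l (edge l) r≤μ) (spells-walk {h = h ∘ +_} sp (gaps-falls P μ) r≤μ))

      word-injective : ∀ {l l′ M M′} → Word ε σ μ M l → Word ε σ μ M′ l′ →
        (∀ j → extend z l j ≡ extend z l′ j) → l ≡ l′
      word-injective {l} {l′} w w′ e = walk-injective z (trans (word-length w) (sym (word-length w′))) λ i i≤ →
        let i≤μ = subst (i ℕ.≤_) (word-length w) i≤ in
        trans (sym (extend-walk z l (edge l) i≤μ)) (trans (e (+ i)) (extend-walk z l′ (edge l′) i≤μ))

    -- Odd s: the left-hand centre is a gap

    module _ (α≡0 : α ≡ 0ℤ) (β≡1 : β ≡ 1ℤ) where

      -- The letters at -1 and 0 mirror each other, and their sum is at least 1; hence both are
      -- positive. Conversely, positivity of these two implies all conditions in the margin.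
      start-odd : Start 0ℤ nonzero
      start-odd = record
        { edge    = λ _ _ → sym (cong (_- 1ℤ) β≡1)
        ; flat    = λ _ _ ()
        ; margin  = λ P _ A → let 1≤f₀ = lead A
                                  0≤f₀ = ℤ.≤-trans (+≤+ z≤n) 1≤f₀
                                  0≤f₋₁ = subst (0ℤ ≤_) (sym (f₋₁ P)) 0≤f₀
                                  1≤f₋₁ = subst (1ℤ ≤_) (sym (f₋₁ P)) 1≤f₀
                                  0≤f₁ = gap₁-nonneg P A 0≤f₋₁
                                  2≤f₋₁+f₀ = ℤ.+-mono-≤ 1≤f₋₁ 1≤f₀ in
            0≤f₋₁ , ℤ.≤-trans (+≤+ (s≤s z≤n)) 2≤f₋₁+f₀ , ℤ.+-mono-≤ 2≤f₋₁+f₀ 0≤f₁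
          , ℤ.+-mono-≤ {+ 1} (ℤ.+-mono-≤ {0ℤ} (subst (0ℤ ≤_) (sym (f₋₂ P)) 0≤f₁) 1≤f₋₁) 1≤f₀
        ; leading = λ {h} P _ C → double-positive (subst (λ x → 1ℤ ≤ x + fall h 0ℤ) (f₋₁ P) (climb₂⇒ P (proj₁ (proj₂ C)) (- + 1)))
        }
        where
        f₋₁ : ∀ {h} → Profile h → fall h (- + 1) ≡ fall h 0ℤ
        f₋₁ {h} P = trans (cong (λ a → fall h (a - 1ℤ - 0ℤ)) (sym α≡0)) (fall-mirrorˡ P 0ℤ)
        f₋₂ : ∀ {h} → Profile h → fall h (- + 2) ≡ fall h 1ℤ
        f₋₂ {h} P = trans (cong (λ a → fall h (a - 1ℤ - 1ℤ)) (sym α≡0)) (fall-mirrorˡ P 1ℤ)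
        double-positive : ∀ {x} → 1ℤ ≤ x + x → 1ℤ ≤ x
        double-positive {+ zero}   (+≤+ ())
        double-positive {+ suc n}  _ = +≤+ (s≤s z≤n)
        double-positive { -[1+ n ]} ()

      hasCount-odd : ∀ {M} → + M ≡ κ + + μ → ∀ {n} → HasCount (Word ε nonzero μ M) n → HasCount (SelfConjugateCore s d) n
      hasCount-odd {M} eM = hasCount-map (partitionOf ∘ extend 0ℤ) injective image
        where
        edge : ∀ l → Edge 0ℤ l
        edge = Start.edge start-odd
        eM′ : + M ≡ 0ℤ + κ + + μ
        eM′ = trans eM (cong (_+ + μ) (sym (ℤ.+-identityˡ κ)))
        climbs : ∀ {l} → Word ε nonzero μ M l → Climbs (extend-profile 0ℤ l (edge l))
        climbs = word⇒climbs start-odd eM′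
        injective : ∀ {l l′} → Word ε nonzero μ M l → Word ε nonzero μ M l′ →
          partitionOf (extend 0ℤ l) ≡ partitionOf (extend 0ℤ l′) → l ≡ l′
        injective {l} {l′} w w′ e = word-injective start-odd w w′
          (partitionOf-injective (extend-profile 0ℤ l (edge l)) (extend-profile 0ℤ l′ (edge l′)) (climbs w) (climbs w′) e)
        zero-at-0 : ∀ {h} → Profile h → h 0ℤ ≡ 0ℤ
        zero-at-0 {h} P = double-zero (trans (cong (λ a → h 0ℤ + h (a - 0ℤ)) (sym α≡0))
          (trans (Profile.antisymmetric P 0ℤ) (cong (_- 1ℤ) β≡1)))
          where
          double-zero : ∀ {x} → x + x ≡ 0ℤ → x ≡ 0ℤ
          double-zero {+ zero} _ = refl
        image : ∀ p → SelfConjugateCore s d p ⇔ (∃[ l ] Word ε nonzero μ M l × p ≡ partitionOf (extend 0ℤ l))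
        image p = mk⇔ f g
          where
          f : SelfConjugateCore s d p → ∃[ l ] Word ε nonzero μ M l × p ≡ partitionOf (extend 0ℤ l)
          f v with valid⇒profile {p} v
          ... | h , P , C , B with climbs⇒word start-odd P C (zero-at-0 P)
          ... | M′ , l , eM″ , w , e with ℤ.+-injective (trans eM″ (sym eM′))
          ... | refl = l , w , partitionOf-unique B (extend-profile 0ℤ l (edge l)) (climbs w) e
          g : (∃[ l ] Word ε nonzero μ M l × p ≡ partitionOf (extend 0ℤ l)) → SelfConjugateCore s d p
          g (l , w , refl) = partitionOf-valid (extend-profile 0ℤ l (edge l)) (climbs w)

    -- Even s: the left-hand centre is a letter

    module _ (α≡-1 : α ≡ - 1ℤ) (β≡0 : β ≡ 0ℤ) where

      -- Reflection fixes the letter at -1, which equals 2 b for b = - h(0). It is either 0 and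
      -- blocks what follows, or at least 2 and then restricts nothing.
      leadState : ℕ → State
      leadState zero    = blocked
      leadState (suc b) = free

      start-even : ∀ b → Start (- + b) (leadState b)
      start-even b = record
        { edge    = λ _ s≡N → ⊥-elim (edge′ s≡N)
        ; flat    = flat′ b
        ; margin  = λ P e A → margin′ b P A (f₋₁ {z = b} P e)
        ; leading = λ P e C → leading′ b P C (f₋₁ {z = b} P e)
        }
        where
        edge′ : s ≢ N
        edge′ s≡N with ≡-by {x = α} {y = 0ℤ} (trans axis (cong +_ (sym s≡N)))
          (solve 2 (λ a s → a :+ s :- s := a :- con 0ℤ) refl α (+ s))
        ... | α≡0 with trans (sym α≡-1) α≡0
        ... | ()
        f₋₁ : ∀ {h z} → Profile h → h 0ℤ ≡ - + z → fall h (- + 1) ≡ + z + + z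
        f₋₁ {h} {z} P e = ≡-by (cong₂ _-_ sum (cong₂ _+_ e e))
          (solve 3 (λ x y z → y :+ x :- (y :+ y) :- (:- con 1ℤ :- (:- z :+ :- z)) := x :- y :+ con 1ℤ :- (z :+ z)) refl
            (h (- + 1)) (h 0ℤ) (+ z))
          where
          sum : h 0ℤ + h (- + 1) ≡ - 1ℤ
          sum = trans (cong (λ a → h 0ℤ + h (a - 0ℤ)) (sym α≡-1)) (trans (Profile.antisymmetric P 0ℤ) (cong (_- 1ℤ) β≡0))
        f₋₂ : ∀ {h} → Profile h → fall h (- + 2) ≡ fall h 0ℤ
        f₋₂ {h} P = trans (cong (λ a → fall h (a - 1ℤ - 0ℤ)) (sym α≡-1)) (fall-mirrorˡ P 0ℤ)
        flat′ : ∀ b {h} → Profile h → h 0ℤ ≡ - + b → leadState b ≡ blocked → fall h (- + 1) ≡ 0ℤ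
        flat′ zero P e _ = f₋₁ {z = 0} P e
        margin′ : ∀ b {h} (P : Profile h) → Admissible (leadState b) μ (gaps P) → fall h (- + 1) ≡ + b + + b → Margin P
        margin′ zero {h} P A e =
            ℤ.≤-reflexive (sym e)
          , subst (1ℤ ≤_) (0+ (fall h 0ℤ)) (proj₁ (lead A))
          , subst (+ 2 ≤_) (cong (_+ fall h 1ℤ) (0+ (fall h 0ℤ))) (proj₂ (lead A))
          , ℤ.+-mono-≤ {1ℤ} {y = fall h (- + 2) + fall h (- + 1)} {1ℤ}
              (subst (1ℤ ≤_) (trans (sym (ℤ.+-identityʳ (fall h 0ℤ))) (cong₂ _+_ (sym (f₋₂ P)) (sym e))) (proj₁ (lead A)))
              (proj₁ (lead A))
          where
          0+ : ∀ x → x ≡ fall h (- + 1) + x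
          0+ x = trans (sym (ℤ.+-identityˡ x)) (cong (_+ x) (sym e))
        margin′ (suc b) {h} P A e =
            0≤f₋₁ , ℤ.+-mono-≤ {1ℤ} {y = fall h (- + 1)} {0ℤ} (ℤ.≤-trans (+≤+ (s≤s z≤n)) 2≤f₋₁) 0≤f₀
          , ℤ.+-mono-≤ {+ 2} {y = fall h (- + 1) + fall h 0ℤ} {0ℤ} (ℤ.+-mono-≤ {+ 2} {y = fall h (- + 1)} {0ℤ} 2≤f₋₁ 0≤f₀) (gap₁-nonneg P A 0≤f₋₁)
          , ℤ.+-mono-≤ {+ 2} {y = fall h (- + 2) + fall h (- + 1)} {0ℤ}
              (ℤ.+-mono-≤ {0ℤ} {y = fall h (- + 2)} {+ 2} (subst (0ℤ ≤_) (sym (f₋₂ P)) 0≤f₀) 2≤f₋₁) 0≤f₀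
          where
          0≤f₀ = single A z≤n
          2≤f₋₁ : + 2 ≤ fall h (- + 1)
          2≤f₋₁ = subst (+ 2 ≤_) (sym e) (+≤+ (s≤s (ℕ.≤-trans (s≤s z≤n) (ℕ.m≤n+m (suc b) b))))
          0≤f₋₁ = ℤ.≤-trans (+≤+ z≤n) 2≤f₋₁
        leading′ : ∀ b {h} (P : Profile h) → Climbs P → fall h (- + 1) ≡ + b + + b → Lead (leadState b) (gaps P)
        leading′ zero {h} P (c₁ , c₂ , c₃) e =
            subst (1ℤ ≤_) (trans (cong (_+ fall h 0ℤ) e) (ℤ.+-identityˡ _)) (climb₂⇒ P c₂ (- + 1))
          , subst (+ 2 ≤_) (cong (_+ fall h 1ℤ) (trans (cong (_+ fall h 0ℤ) e) (ℤ.+-identityˡ (fall h 0ℤ)))) (climb₃⇒ P c₃ (- + 1))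
        leading′ (suc b) P C e = tt

      free-cons : ∀ {k M l} b → Word ε (leadState b) k M l → Word ε free (suc k) (b ℕ.+ M) (b ∷ l)
      free-cons zero    w = free-zero w
      free-cons (suc b) w = free-suc (nonzero-word b w)

      free-uncons : ∀ {k M l} → Word ε free (suc k) M l →
        ∃[ b ] ∃[ l′ ] ∃[ M′ ] l ≡ b ∷ l′ × M ≡ b ℕ.+ M′ × Word ε (leadState b) k M′ l′
      free-uncons w with uncons w
      ... | free-0 w′   = 0 , _ , _ , refl , refl , w′
      ... | free-1+ a w′ = suc a , _ , _ , refl , refl , w′

      -- The first letter is half of the letter at -1 and encodes the starting height. The value at
      -- the empty list is a dummy, since the words in question have length `suc μ`.
      toHeights : List ℕ → ℤ → ℤ
      toHeights []      = λ _ → 0ℤ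
      toHeights (b ∷ l) = extend (- + b) l

      hasCount-even : ∀ {M} → + M ≡ κ + + μ → ∀ {n} → HasCount (Word ε free (suc μ) M) n → HasCount (SelfConjugateCore s d) n
      hasCount-even {M} eM = hasCount-map (partitionOf ∘ toHeights) injective image
        where
        edge : ∀ b l → Edge (- + b) l
        edge b = Start.edge (start-even b)
        remainder : ∀ {b M′} → M ≡ b ℕ.+ M′ → + M′ ≡ - + b + κ + + μ
        remainder {b} {M′} e = ≡-by (trans (cong +_ (sym e)) eM)
          (solve 4 (λ b m κ μ → b :+ m :- (κ :+ μ) := m :- (:- b :+ κ :+ μ)) refl (+ b) (+ M′) κ (+ μ))
        climbs : ∀ b {M′ l} → M ≡ b ℕ.+ M′ → Word ε (leadState b) μ M′ l → Climbs (extend-profile (- + b) l (edge b l))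
        climbs b e w = word⇒climbs (start-even b) (remainder e) w
        injective : ∀ {l l′} → Word ε free (suc μ) M l → Word ε free (suc μ) M l′ →
          partitionOf (toHeights l) ≡ partitionOf (toHeights l′) → l ≡ l′
        injective w w′ e with free-uncons w | free-uncons w′
        ... | b , l , _ , refl , eb , v | b′ , l′ , _ , refl , eb′ , v′ = go b≡b′ v′ heights
          where
          heights : ∀ j → extend (- + b) l j ≡ extend (- + b′) l′ j
          heights = partitionOf-injective (extend-profile (- + b) l (edge b l)) (extend-profile (- + b′) l′ (edge b′ l′))
            (climbs b eb v) (climbs b′ eb′ v′) e
          b≡b′ : b ≡ b′
          b≡b′ = ℤ.+-injective (ℤ.neg-injective
            (trans (sym (extend-walk (- + b) l (edge b l) z≤n)) (trans (heights 0ℤ) (extend-walk (- + b′) l′ (edge b′ l′) z≤n))))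
          go : ∀ {b′ M′} → b ≡ b′ → Word ε (leadState b′) μ M′ l′ → (∀ j → extend (- + b) l j ≡ extend (- + b′) l′ j) → b ∷ l ≡ b′ ∷ l′
          go refl v′ hs = cong (b ∷_) (word-injective (start-even b) v v′ hs)
        image : ∀ p → SelfConjugateCore s d p ⇔ (∃[ l ] Word ε free (suc μ) M l × p ≡ partitionOf (toHeights l))
        image p = mk⇔ f g
          where
          f : SelfConjugateCore s d p → ∃[ l ] Word ε free (suc μ) M l × p ≡ partitionOf (toHeights l)
          f v with valid⇒profile {p} v
          ... | h , P , C , B with double-nonneg (- h 0ℤ) z≤n (subst (0ℤ ≤_) f₋₁ (climb₁⇒ P (proj₁ C) (- + 1)))
            where
            sum : h 0ℤ + h (- + 1) ≡ - 1ℤ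
            sum = trans (cong (λ a → h 0ℤ + h (a - 0ℤ)) (sym α≡-1)) (trans (Profile.antisymmetric P 0ℤ) (cong (_- 1ℤ) β≡0))
            f₋₁ : fall h (- + 1) ≡ - h 0ℤ + - h 0ℤ + + 0
            f₋₁ = ≡-by sum (solve 2 (λ x y → y :+ x :- :- con 1ℤ := x :- y :+ con 1ℤ :- (:- y :+ :- y :+ con 0ℤ)) refl (h (- + 1)) (h 0ℤ))
          ... | b , eb with climbs⇒word (start-even b) P C (trans (sym (ℤ.neg-involutive (h 0ℤ))) (cong (-_) eb))
          ... | M′ , l , eM′ , w , e with ℤ.+-injective {M} {b ℕ.+ M′} (trans eM (≡-by (sym eM′)
                (solve 4 (λ b m κ μ → :- b :+ κ :+ μ :- m := κ :+ μ :- (b :+ m)) refl (+ b) (+ M′) κ (+ μ))))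
          ... | eb+M′ = b ∷ l , subst (λ M → Word ε free (suc μ) M (b ∷ l)) (sym eb+M′) (free-cons b w) ,
                partitionOf-unique B (extend-profile (- + b) l (edge b l)) (climbs b eb+M′ w) e
          g : (∃[ l ] Word ε free (suc μ) M l × p ≡ partitionOf (toHeights l)) → SelfConjugateCore s d p
          g (l , w , refl) with free-uncons w
          ... | b , l′ , _ , refl , eb , v = partitionOf-valid (extend-profile (- + b) l′ (edge b l′)) (climbs b eb v)

  -- Coordinates for the parities of s and d

  bezout-ℤ : ∀ {s d} → Coprime s d → ∃[ u ] ∃[ v ] u * + d + v * + s ≡ 1ℤ
  bezout-ℤ {s} {d} coprime with coprime-Bézout coprime
  ... | Bézout.+- x y e = - + y , + x , ≡-by (cong +_ (sym e)) (trans
          (cong₂ (λ a b → a - (1ℤ + b)) (ℤ.pos-* x s) (ℤ.pos-* y d))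
          (solve 4 (λ x y s d → x :* s :- (con 1ℤ :+ y :* d) := :- y :* d :+ x :* s :- con 1ℤ) refl (+ x) (+ y) (+ s) (+ d)))
  ... | Bézout.-+ x y e = + y , - + x , ≡-by (cong +_ (sym e)) (trans
          (cong₂ (λ a b → a - (1ℤ + b)) (ℤ.pos-* y d) (ℤ.pos-* x s))
          (solve 4 (λ x y s d → y :* d :- (con 1ℤ :+ x :* s) := y :* d :+ :- x :* s :- con 1ℤ) refl (+ x) (+ y) (+ s) (+ d)))

  -- For odd s, c = - m solves 2 c + s = 1, so α = 0 and β = 1. Then `level` reads 2 κ + ε = d + 1:
  -- even d gives ε = 1 and κ = e, odd d gives ε = 0 and κ = e + 1.
  hasCount-odd-even : ∀ m e → let s = suc (m ℕ.+ m) ; d = e ℕ.+ e in Coprime s d →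
    ∀ {n} → HasCount (Word 1 nonzero m (m ℕ.+ e)) n → HasCount (SelfConjugateCore s d) n
  hasCount-odd-even m e coprime with bezout-ℤ coprime
  ... | u , v , bezout = Folded.hasCount-odd (suc (m ℕ.+ m)) (e ℕ.+ e) u v 0ℤ 1ℤ (- + m) bezout
    (solve 2 (λ m e → :- m :+ :- m :+ (con 0ℤ :* (e :+ e) :+ con 1ℤ :* (con 1ℤ :+ (m :+ m))) := con 1ℤ) refl (+ m) (+ e))
    m 1 (+ e) refl ℕ.≤-refl (ℕ.n≤1+n _) ℕ.≤-refl
    (solve 1 (λ e → e :+ e :+ con 1ℤ := e :+ e :+ con (+ 2) :- con 1ℤ) refl (+ e))
    refl refl (cong +_ (ℕ.+-comm m e))

  hasCount-odd-odd : ∀ m e → let s = suc (m ℕ.+ m) ; d = suc (e ℕ.+ e) in Coprime s d →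
    ∀ {n} → HasCount (Word 0 nonzero m (suc (m ℕ.+ e))) n → HasCount (SelfConjugateCore s d) n
  hasCount-odd-odd m e coprime with bezout-ℤ coprime
  ... | u , v , bezout = Folded.hasCount-odd (suc (m ℕ.+ m)) (suc (e ℕ.+ e)) u v 0ℤ 1ℤ (- + m) bezout
    (solve 2 (λ m e → :- m :+ :- m :+ (con 0ℤ :* (con 1ℤ :+ (e :+ e)) :+ con 1ℤ :* (con 1ℤ :+ (m :+ m))) := con 1ℤ) refl (+ m) (+ e))
    m 0 (+ suc e) refl ℕ.≤-refl (ℕ.n≤1+n _) z≤n
    (solve 1 (λ e → con 1ℤ :+ e :+ (con 1ℤ :+ e) :+ con 0ℤ := con 1ℤ :+ (e :+ e) :+ con (+ 2) :- con 1ℤ) refl (+ e))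
    refl refl (cong +_ (cong suc (ℕ.+-comm m e)))

  -- For even s, `centre` forces α to be odd. With α = -1 and β = 0 it reads 2 c = d + 1, and
  -- `level` becomes 2 κ + ε = d + 2, so c = κ = e + 1 and ε = 1.
  hasCount-even-odd : ∀ m e → let s = suc m ℕ.+ suc m ; d = suc (e ℕ.+ e) in Coprime s d →
    ∀ {n} → HasCount (Word 1 free (suc m) (suc m ℕ.+ e)) n → HasCount (SelfConjugateCore s d) n
  hasCount-even-odd m e coprime with bezout-ℤ coprime
  ... | u , v , bezout = Folded.hasCount-even (suc m ℕ.+ suc m) (suc (e ℕ.+ e)) u v (- 1ℤ) 0ℤ (+ suc e) bezout
    (solve 2 (λ m e → con 1ℤ :+ e :+ (con 1ℤ :+ e) :+ (:- con 1ℤ :* (con 1ℤ :+ (e :+ e)) :+ con 0ℤ :* (con 1ℤ :+ m :+ (con 1ℤ :+ m))) := con 1ℤ)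
      refl (+ m) (+ e))
    m 1 (+ suc e) (cong +_ (ℕ.+-suc m m)) (ℕ.m≤n⇒m≤1+n (ℕ.≤-reflexive (sym (ℕ.+-suc m m)))) (ℕ.≤-reflexive (cong suc (ℕ.+-suc m m))) ℕ.≤-refl
    (solve 1 (λ e → con 1ℤ :+ e :+ (con 1ℤ :+ e) :+ con 1ℤ := con 1ℤ :+ (e :+ e) :+ con (+ 2) :- con 0ℤ) refl (+ e))
    refl refl (cong +_ (cong suc (ℕ.+-comm m e)))

open import Data.Nat.Base using (_+_; _*_; _∸_; _≤_; _<_)
open import Data.Nat.Combinatorics using (_C_; nCk+nC[k+1]≡[n+1]C[k+1])
open import Data.Nat.Divisibility using (_∣_; divides; ∣1⇒≡1; ∣m+n∣m⇒∣n)
open import Data.Nat.DivMod using (_/_)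
import Data.Nat.DivMod as ℕ
open import Data.Nat.ListAction using (sum)
open import Data.Nat.Solver using (module +-*-Solver)
open +-*-Solver using (solve; con; _:+_; _:*_; _:=_)

-- Counting words

-- R i A B m = ∑ᵣ C(A - r, m - 2r) C(B - r, i + r), the sum stopping before either
-- difference becomes negative.
R : ℕ → ℕ → ℕ → ℕ → ℕ
R i A       B       0             = (A C 0) * (B C i)
R i A       B       1             = (A C 1) * (B C i)
R i zero    B       (suc (suc m)) = 0
R i (suc A) zero    (suc (suc m)) = (suc A C suc (suc m)) * (zero C i)
R i (suc A) (suc B) (suc (suc m)) = (suc A C suc (suc m)) * (suc B C i) + R (suc i) A B m

F : ℕ → ℕ → ℕ → ℕ
F i A m = R i A A m

pascal : ∀ n k → suc n C suc k ≡ n C k + n C suc k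
pascal n k = sym (nCk+nC[k+1]≡[n+1]C[k+1] n k)

F-zero : ∀ i m → F i 0 (suc m) ≡ 0
F-zero i zero    = refl
F-zero i (suc m) = refl

F-suc-zero : ∀ i m → F (suc i) 0 m ≡ 0
F-suc-zero i zero          = refl
F-suc-zero i (suc zero)    = refl
F-suc-zero i (suc (suc m)) = refl

-- Pascal's rule in both factors of every summand.
F-suc-recurrence : ∀ i A m →
  F (suc i) (suc A) (suc m) ≡ F (suc i) A (suc m) + F (suc i) A m + F i A (suc m) + F i A m
F-suc-recurrence i A zero rewrite pascal A i | pascal A 0 =
  solve 3 (λ a b c → (con 1 :+ a) :* (b :+ c) := a :* c :+ con 1 :* c :+ a :* b :+ con 1 :* b) refl
    (A C 1) (A C i) (A C suc i)
F-suc-recurrence i zero (suc m)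
  rewrite F-suc-zero (suc i) m | F-zero (suc i) m | F-zero i m | pascal 0 (suc m) = refl
F-suc-recurrence i (suc A) (suc zero)
  rewrite pascal (suc A) 1 | pascal (suc A) i | pascal A (suc i) =
  solve 6 (λ x y b c a e → (x :+ y) :* (b :+ c) :+ con 1 :* (a :+ e)
      := y :* c :+ con 1 :* e :+ x :* c :+ (y :* b :+ con 1 :* a) :+ x :* b) refl
    (suc A C 1) (suc A C 2) (suc A C i) (suc A C suc i) (A C suc i) (A C suc (suc i))
F-suc-recurrence i (suc A) (suc (suc m))
  rewrite F-suc-recurrence (suc i) A m | pascal (suc A) (suc (suc m)) | pascal (suc A) i =
  solve 8 (λ x y b c p q r t → (x :+ y) :* (b :+ c) :+ (p :+ q :+ r :+ t)
      := y :* c :+ p :+ (x :* c :+ q) :+ (y :* b :+ r) :+ (x :* b :+ t)) refl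
    (suc A C suc (suc m)) (suc A C suc (suc (suc m))) (suc A C i) (suc A C suc i)
    (F (suc (suc i)) A (suc m)) (F (suc (suc i)) A m) (F (suc i) A (suc m)) (F (suc i) A m)

-- With D = 1 - z (1 + y) (1 + z y²), where z marks A and y marks m, the functions F 0, G,
-- F₂ and H have the generating functions 1 / D, z (1 + y) / D, z y² / D and
-- z (1 + y + z y²) / D.
G : ℕ → ℕ → ℕ
G zero    m       = 0
G (suc A) zero    = F 0 A 0
G (suc A) (suc m) = F 0 A m + F 0 A (suc m)

F-recurrence-1 : ∀ A → F 0 (suc A) 1 ≡ F 0 A 1 + F 0 A 0
F-recurrence-1 A rewrite pascal A 0 =
  solve 1 (λ a → (con 1 :+ a) :* con 1 := a :* con 1 :+ con 1) refl (A C 1)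

-- This is D · (1 / D) = 1 read off coefficientwise; the term z² y² (1 + y) / D is z y² times the
-- series of `G`.
F-recurrence : ∀ A m → F 0 (suc A) (suc (suc m)) ≡ F 0 A (suc (suc m)) + F 0 A (suc m) + G A m
F-recurrence zero    zero    = refl
F-recurrence zero    (suc m) rewrite F-suc-zero 0 (suc m) = refl
F-recurrence (suc A) zero
  rewrite pascal (suc A) 1 | pascal A 0 =
  solve 2 (λ a b → (con 1 :+ a :+ b) :* con 1 :+ con 1 :* (con 1 :+ a)
      := b :* con 1 :+ con 1 :* a :+ (con 1 :+ a) :* con 1 :+ con 1) refl
    (A C 1) (suc A C 2)
F-recurrence (suc A) (suc m)
  rewrite F-suc-recurrence 0 A m | pascal (suc A) (suc (suc m)) =
  solve 6 (λ x y p q r t → (x :+ y) :* con 1 :+ (p :+ q :+ r :+ t)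
      := y :* con 1 :+ p :+ (x :* con 1 :+ q) :+ (t :+ r)) refl
    (suc A C suc (suc m)) (suc A C suc (suc (suc m)))
    (F 1 A (suc m)) (F 1 A m) (F 0 A (suc m)) (F 0 A m)

R-pascalˡ : ∀ i A m → R i (suc A) A (suc m) ≡ F i A m + F i A (suc m)
R-pascalˡ i A zero rewrite pascal A 0 = 
  solve 2 (λ a b → (con 1 :+ a) :* b := con 1 :* b :+ a :* b) refl (A C 1) (A C i)
R-pascalˡ i zero (suc m) rewrite F-zero i m = refl
R-pascalˡ i (suc A) (suc zero) rewrite pascal (suc A) 1 =
  solve 4 (λ x y b c → (x :+ y) :* b :+ con 1 :* c := x :* b :+ (y :* b :+ con 1 :* c)) refl
    (suc A C 1) (suc A C 2) (suc A C i) (A C suc i)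
R-pascalˡ i (suc A) (suc (suc m)) rewrite pascal (suc A) (suc (suc m)) | R-pascalˡ (suc i) A m =
  solve 5 (λ x y b p q → (x :+ y) :* b :+ (p :+ q) := x :* b :+ p :+ (y :* b :+ q)) refl
    (suc A C suc (suc m)) (suc A C suc (suc (suc m))) (suc A C i) (F (suc i) A m) (F (suc i) A (suc m))

R-pascalʳ : ∀ i A m → R (suc i) A (suc A) m ≡ F i A m + F (suc i) A m
R-pascalʳ i A zero rewrite pascal A i =
  solve 2 (λ b c → con 1 :* (b :+ c) := con 1 :* b :+ con 1 :* c) refl (A C i) (A C suc i)
R-pascalʳ i A (suc zero) rewrite pascal A i =
  solve 3 (λ a b c → a :* (b :+ c) := a :* b :+ a :* c) refl (A C 1) (A C i) (A C suc i)
R-pascalʳ i zero (suc (suc m)) = refl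
R-pascalʳ i (suc A) (suc (suc m)) rewrite pascal (suc A) i | R-pascalʳ (suc i) A m =
  solve 5 (λ x b c p q → x :* (b :+ c) :+ (p :+ q) := x :* b :+ p :+ (x :* c :+ q)) refl
    (suc A C suc (suc m)) (suc A C i) (suc A C suc i) (F (suc i) A m) (F (suc (suc i)) A m)

F₂ : ℕ → ℕ → ℕ
F₂ A       zero          = 0
F₂ A       (suc zero)    = 0
F₂ zero    (suc (suc m)) = 0
F₂ (suc A) (suc (suc m)) = F 0 A m

-- For i = 0 the summand r = 0 has no lower neighbour in Pascal's rule. The remaining ones,
-- reindexed by r - 1, sum to `F₂`.
R-pascalʳ-0 : ∀ A m → R 0 A (suc A) m ≡ F 0 A m + F₂ A m
R-pascalʳ-0 zero    zero          = refl
R-pascalʳ-0 zero    (suc zero)    = refl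
R-pascalʳ-0 zero    (suc (suc m)) = refl
R-pascalʳ-0 (suc A) zero          = refl
R-pascalʳ-0 (suc A) (suc zero)    = solve 1 (λ a → a := a :+ con 0) refl _
R-pascalʳ-0 (suc A) (suc (suc m)) rewrite R-pascalʳ 0 A m =
  solve 3 (λ x p q → x :+ (p :+ q) := x :+ q :+ p) refl
    ((suc A C suc (suc m)) * 1) (F 0 A m) (F 1 A m)

-- The binomial sums of the theorem

/2-suc : ∀ m → suc (suc m) / 2 ≡ suc (m / 2)
/2-suc m = ℕ.m/n≡1+[m∸n]/n {suc (suc m)} {2} (s≤s (s≤s z≤n))

∑-suc : ∀ n f → ∑[0⋯ suc n ] f ≡ f 0 + ∑[0⋯ n ] (f ∘ suc)
∑-suc n f = cong (λ xs → f 0 + sum (f 1 ∷ xs)) (trans (List.map-applyUpTo (λ i → suc (suc i)) f n)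
  (sym (List.map-applyUpTo suc (f ∘ suc) n)))

∑-cong : ∀ n {f g} → (∀ i → f i ≡ g i) → ∑[0⋯ n ] f ≡ ∑[0⋯ n ] g
∑-cong n e = cong sum (List.map-cong e (upTo (suc n)))

-- Removing the summand r = 0 raises the second lower index, hence the general i. The bound m ≤ A
-- ensures that A ∸ r is never truncated.
∑≡F : ∀ i A m → m ≤ A →
  ∑[0⋯ m / 2 ] (λ r → ((A ∸ r) C (m ∸ 2 * r)) * ((A ∸ r) C (i + r))) ≡ F i A m
∑≡F i A zero _ rewrite ℕ.+-identityʳ i = ℕ.+-identityʳ _
∑≡F i A (suc zero) _ rewrite ℕ.+-identityʳ i = ℕ.+-identityʳ _
∑≡F i (suc A) (suc (suc m)) (s≤s m<A) rewrite /2-suc m = trans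
  (∑-suc (m / 2) (λ r → ((suc A ∸ r) C (suc (suc m) ∸ 2 * r)) * ((suc A ∸ r) C (i + r))))
  (cong₂ _+_ (cong (λ j → (suc A C suc (suc m)) * (suc A C j)) (ℕ.+-identityʳ i))
    (trans (∑-cong (m / 2) λ r → cong₂ (λ a b → ((A ∸ r) C (suc (suc m) ∸ a)) * ((A ∸ r) C b))
        (ℕ.*-suc 2 r) (ℕ.+-suc i r))
      (∑≡F (suc i) A m (ℕ.<⇒≤ m<A))))

Rodd : ℕ → ℕ → ℕ → ℕ → ℕ
Rodd i A B zero    = 0
Rodd i A B (suc m) = R i A (B ∸ 1) m

-- Indices 2 q contribute the q-th summand of `R i A B m`, and indices 2 q + 1 that of
-- `R i A (B ∸ 1) (m ∸ 1)`.
∑≡R : ∀ i A B m → m ≤ A → m ≤ B →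
  ∑[0⋯ m ] (λ r → ((A ∸ r / 2) C (m ∸ r)) * ((B ∸ (r + 1) / 2) C (i + r / 2))) ≡ R i A B m + Rodd i A B m
∑≡R i A B zero _ _ rewrite ℕ.+-identityʳ i = refl
∑≡R i A B (suc zero) _ _ rewrite ℕ.+-identityʳ i =
  solve 2 (λ a b → a :+ (b :+ con 0) := a :+ b) refl ((A C 1) * (B C i)) (1 * ((B ∸ 1) C i))
∑≡R i (suc A) (suc B) (suc (suc m)) (s≤s m<A) (s≤s m<B) = begin
  ∑[0⋯ suc (suc m) ] f
    ≡⟨ trans (∑-suc (suc m) f) (cong (f 0 +_) (∑-suc m (f ∘ suc))) ⟩
  f 0 + (f 1 + ∑[0⋯ m ] (f ∘ suc ∘ suc))
    ≡⟨ cong₂ (λ a b → a + (b + ∑[0⋯ m ] (f ∘ suc ∘ suc)))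
         (cong (λ j → (suc A C suc (suc m)) * (suc B C j)) (ℕ.+-identityʳ i))
         (cong (λ j → (suc A C suc m) * (B C j)) (ℕ.+-identityʳ i)) ⟩
  t + (t′ + ∑[0⋯ m ] (f ∘ suc ∘ suc))
    ≡⟨ cong (λ a → t + (t′ + a)) (trans (∑-cong m shift) (∑≡R (suc i) A B m (ℕ.<⇒≤ m<A) (ℕ.<⇒≤ m<B))) ⟩
  t + (t′ + (R (suc i) A B m + Rodd (suc i) A B m))
    ≡⟨ solve 4 (λ a b c d → a :+ (b :+ (c :+ d)) := a :+ c :+ (b :+ d)) refl t t′ (R (suc i) A B m) (Rodd (suc i) A B m) ⟩
  t + R (suc i) A B m + (t′ + Rodd (suc i) A B m)
    ≡⟨ cong (t + R (suc i) A B m +_) (odd B m m<B) ⟩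
  R i (suc A) (suc B) (suc (suc m)) + Rodd i (suc A) (suc B) (suc (suc m)) ∎
  where
  open ≡-Reasoning
  f : ℕ → ℕ
  f r = ((suc A ∸ r / 2) C (suc (suc m) ∸ r)) * ((suc B ∸ (r + 1) / 2) C (i + r / 2))
  t t′ : ℕ
  t  = (suc A C suc (suc m)) * (suc B C i)
  t′ = (suc A C suc m) * (B C i)
  shift : ∀ r → f (suc (suc r)) ≡ ((A ∸ r / 2) C (m ∸ r)) * ((B ∸ (r + 1) / 2) C (suc i + r / 2))
  shift r rewrite /2-suc r | /2-suc (r + 1) | ℕ.+-suc i (r / 2) = refl
  -- The term of index 1 is the first summand of the odd part.
  odd : ∀ B m → m < B → (suc A C suc m) * (B C i) + Rodd (suc i) A B m ≡ R i (suc A) B (suc m)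
  odd B       zero    _ = ℕ.+-identityʳ _
  odd (suc B) (suc m) _ = refl

-- Recurrences for the numbers of words

indicator : ∀ {X : Set} → Dec X → ℕ
indicator (yes _) = 1
indicator (no  _) = 0

module _ (ε : ℕ) where

  -- Raising the first letter by one costs one unit of M. So each constructor of `Word` gives one
  -- summand, and no sum over the values of a letter arises.
  freeCount blockedCount nonzeroCount : ℕ → ℕ → ℕ
  freeCount     zero    M       = 1
  freeCount     (suc k) M       = blockedCount k M + nonzeroCount (suc k) M
  blockedCount  zero    M       = indicator (2 ℕ.≤? M + M + ε)
  blockedCount  (suc k) zero    = 0
  blockedCount  (suc k) (suc M) = nonzeroCount k M + nonzeroCount (suc k) M
  nonzeroCount zero    M       = indicator (1 ℕ.≤? M + M + ε)
  nonzeroCount (suc k) zero    = 0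
  nonzeroCount (suc k) (suc M) = freeCount k M + nonzeroCount (suc k) M

  private
    head : List ℕ → ℕ
    head []      = 0
    head (a ∷ _) = a

    incHead : List ℕ → List ℕ
    incHead []      = []
    incHead (a ∷ l) = suc a ∷ l

    nonzero-head : ∀ {k M l} → Word ε nonzero (suc k) M l → 1 ≤ head l
    nonzero-head (nonzero-one w) = s≤s z≤n
    nonzero-head (nonzero-suc w) = s≤s z≤n

    incHead-injective : ∀ {k M l l′} → Word ε nonzero (suc k) M l → Word ε nonzero (suc k) M l′ →
      incHead l ≡ incHead l′ → l ≡ l′
    incHead-injective {l = _ ∷ _} {_ ∷ _} _ _ refl = refl

    empty : ∀ {X : Set} (X? : Dec X) → HasCount {List ℕ} (λ l → X × l ≡ []) (indicator X?)
    empty (yes x) = hasCount-single [] λ l → mk⇔ (x ,_) proj₂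
    empty (no ¬x) = hasCount-∅ λ l → ¬x ∘ proj₁

    -- The alternatives are disjoint: the first letter is 1 in one of them and at least 2 in the
    -- other.
    bump : ∀ {k M m n} {X : List ℕ → Set} → HasCount X m → HasCount (Word ε nonzero (suc k) M) n →
      HasCount (λ l → (∃[ l′ ] X l′ × l ≡ 1 ∷ l′) ⊎ (∃[ l′ ] Word ε nonzero (suc k) M l′ × l ≡ incHead l′)) (m + n)
    bump hx hw = hasCount-⊎
      (λ { l (_ , _ , refl) (_ ∷ _ , w , e) → ℕ.<-irrefl (List.∷-injectiveˡ e) (s≤s (nonzero-head w)) })
      (hasCount-map (1 ∷_) (λ _ _ → List.∷-injectiveʳ) (λ _ → mk⇔ id id) hx)
      (hasCount-map incHead incHead-injective (λ _ → mk⇔ id id) hw)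

  free-hasCount     : ∀ k M → HasCount (Word ε free k M) (freeCount k M)
  blocked-hasCount  : ∀ k M → HasCount (Word ε blocked k M) (blockedCount k M)
  nonzero-hasCount : ∀ k M → HasCount (Word ε nonzero k M) (nonzeroCount k M)

  free-hasCount zero    M = hasCount-single [] λ l → mk⇔ (λ { refl → end-free }) (λ { end-free → refl })
  free-hasCount (suc k) M = hasCount-cong
    (λ l → mk⇔
      (λ { (inj₁ (_ , w , refl)) → free-zero w ; (inj₂ w) → free-suc w })
      (λ { (free-zero w) → inj₁ (_ , w , refl) ; (free-suc w) → inj₂ w }))
    (hasCount-⊎ (λ { l (_ , _ , refl) w → ℕ.<-irrefl refl (nonzero-head w) })
      (hasCount-map (0 ∷_) (λ _ _ → List.∷-injectiveʳ) (λ _ → mk⇔ id id) (blocked-hasCount k M))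
      (nonzero-hasCount (suc k) M))
  blocked-hasCount zero M = hasCount-cong
    (λ l → mk⇔ (λ { (p , refl) → end-blocked p }) (λ { (end-blocked p) → p , refl }))
    (empty (2 ℕ.≤? M + M + ε))
  blocked-hasCount (suc k) zero = hasCount-∅ λ _ ()
  blocked-hasCount (suc k) (suc M) = hasCount-cong
    (λ l → mk⇔
      (λ { (inj₁ (_ , w , refl)) → blocked-one w ; (inj₂ (_ ∷ _ , w , refl)) → blocked-suc w })
      (λ { (blocked-one w) → inj₁ (_ , w , refl) ; (blocked-suc w) → inj₂ (_ , w , refl) }))
    (bump (nonzero-hasCount k M) (nonzero-hasCount (suc k) M))
  nonzero-hasCount zero M = hasCount-cong
    (λ l → mk⇔ (λ { (p , refl) → end-nonzero p }) (λ { (end-nonzero p) → p , refl }))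
    (empty (1 ℕ.≤? M + M + ε))
  nonzero-hasCount (suc k) zero = hasCount-∅ λ _ ()
  nonzero-hasCount (suc k) (suc M) = hasCount-cong
    (λ l → mk⇔
      (λ { (inj₁ (_ , w , refl)) → nonzero-one w ; (inj₂ (_ ∷ _ , w , refl)) → nonzero-suc w })
      (λ { (nonzero-one w) → inj₁ (_ , w , refl) ; (nonzero-suc w) → inj₂ (_ , w , refl) }))
    (bump (free-hasCount k M) (nonzero-hasCount (suc k) M))

-- Closed forms for the numbers of words

indicator-yes : ∀ {X : Set} (X? : Dec X) → X → indicator X? ≡ 1
indicator-yes (yes _) x = refl
indicator-yes (no ¬x) x = ⊥-elim (¬x x)

2≤suc+suc : ∀ n ε → 2 ≤ suc n + suc n + ε
2≤suc+suc n ε = ℕ.≤-trans (ℕ.≤-trans (s≤s (s≤s z≤n)) (ℕ.≤-reflexive (cong suc (sym (ℕ.+-suc n n))))) (ℕ.m≤m+n _ ε)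

-- For ε = 1 the central letter is always positive, so row 0 is constantly 1. Unfolding `freeCount`
-- turns the recurrence for words into `F-recurrence`, with `G` in the place of the blocked words.
nonzeroCount-odd : ∀ k M → nonzeroCount 1 k M ≡ F 0 M k
blockedCount-odd  : ∀ k M → blockedCount 1 k M ≡ G M k

nonzeroCount-odd zero M = indicator-yes (1 ℕ.≤? M + M + 1) (ℕ.m≤n+m 1 (M + M))
nonzeroCount-odd (suc k) zero = sym (F-zero 0 k)
nonzeroCount-odd (suc zero) (suc M) rewrite nonzeroCount-odd 1 M =
  trans (ℕ.+-comm 1 _) (sym (F-recurrence-1 M))
nonzeroCount-odd (suc (suc k)) (suc M)
  rewrite F-recurrence M k | blockedCount-odd k M | nonzeroCount-odd (suc k) M | nonzeroCount-odd (suc (suc k)) M =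
  solve 3 (λ a b c → a :+ b :+ c := c :+ b :+ a) refl (G M k) (F 0 M (suc k)) (F 0 M (suc (suc k)))
blockedCount-odd zero    zero    = refl
blockedCount-odd zero    (suc M) = indicator-yes (2 ℕ.≤? suc M + suc M + 1) (2≤suc+suc M 1)
blockedCount-odd (suc k) zero    = refl
blockedCount-odd (suc k) (suc M) = cong₂ _+_ (nonzeroCount-odd k M) (nonzeroCount-odd (suc k) M)

H : ℕ → ℕ → ℕ
H zero    m = 0
H (suc A) m = G (suc A) m + F₂ A m

F₂-sum : ∀ A m → F₂ A (suc m) + F₂ A (suc (suc m)) ≡ G A m
F₂-sum zero    zero    = refl
F₂-sum zero    (suc m) = refl
F₂-sum (suc A) zero    = refl
F₂-sum (suc A) (suc m) = refl

-- In generating functions, (1 + y) z (1 + y + z y²) = (1 - D) + y z (1 + y). After division by D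
-- the two sides differ by 1, which affects only the power 0 of y.
H-sum : ∀ M k → H M k + H M (suc k) ≡ F 0 M (suc k) + G M k
H-sum zero    k       = sym (cong (_+ 0) (F-zero 0 k))
H-sum (suc A) zero rewrite F-recurrence-1 A =
  solve 1 (λ a → con 1 :+ (con 1 :+ a :+ con 0) := a :+ con 1 :+ con 1) refl (F 0 A 1)
H-sum (suc A) (suc k) rewrite F-recurrence A k | sym (F₂-sum A k) =
  solve 5 (λ a b c x y → a :+ b :+ x :+ (b :+ c :+ y) := c :+ b :+ (x :+ y) :+ (a :+ b)) refl
    (F 0 A k) (F 0 A (suc k)) (F 0 A (suc (suc k))) (F₂ A (suc k)) (F₂ A (suc (suc k)))

blockedCount-zero : ∀ k → blockedCount 0 k 0 ≡ 0
blockedCount-zero zero    = refl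
blockedCount-zero (suc k) = refl

H-suc : ∀ k M {b p q} → p ≡ H (suc M) (suc k) → q ≡ H (suc M) (suc (suc k)) →
  b + F 0 M (suc k) ≡ F 0 (suc M) (suc k) → b + p + q ≡ H (suc (suc M)) (suc (suc k))
H-suc k M {b} refl refl e rewrite sym e | F-recurrence M k | sym (F₂-sum M k) =
  solve 6 (λ z a b c x y → z :+ (a :+ b :+ x) :+ (b :+ c :+ y)
      := z :+ b :+ (c :+ b :+ (x :+ y)) :+ a) refl
    b (F 0 M k) (F 0 M (suc k)) (F 0 M (suc (suc k))) (F₂ M (suc k)) (F₂ M (suc (suc k)))

-- For ε = 0 the central letter can vanish, so the counts are 0 at M = 0. The blocked words number a
-- difference of two values of `F 0`, written without subtraction.
nonzeroCount-even : ∀ k M → nonzeroCount 0 k M ≡ H M k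
blockedCount-even : ∀ k M → blockedCount 0 k (suc M) + F 0 M (suc k) ≡ F 0 (suc M) (suc k)

nonzeroCount-even zero zero = refl
nonzeroCount-even zero (suc M) = indicator-yes (1 ℕ.≤? suc M + suc M + 0) (s≤s z≤n)
nonzeroCount-even (suc k) zero = refl
nonzeroCount-even (suc zero) (suc zero) = refl
nonzeroCount-even (suc zero) (suc (suc M)) rewrite nonzeroCount-even 1 (suc M) | F-recurrence-1 M =
  solve 1 (λ a → con 1 :+ (con 1 :+ a :+ con 0) := con 1 :+ (a :+ con 1) :+ con 0) refl (F 0 M 1)
nonzeroCount-even (suc (suc k)) (suc zero)
  rewrite nonzeroCount-even (suc k) 0 | nonzeroCount-even (suc (suc k)) 0 | F-zero 0 k | blockedCount-zero k = refl
nonzeroCount-even (suc (suc k)) (suc (suc M)) = H-suc k M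
  (nonzeroCount-even (suc k) (suc M)) (nonzeroCount-even (suc (suc k)) (suc M)) (blockedCount-even k M)
blockedCount-even zero M rewrite indicator-yes (2 ℕ.≤? suc M + suc M + 0) (2≤suc+suc M 0) =
  trans (ℕ.+-comm 1 _) (sym (F-recurrence-1 M))
blockedCount-even (suc k) M
  rewrite nonzeroCount-even k M | nonzeroCount-even (suc k) M | H-sum M k | F-recurrence M k =
  solve 3 (λ a b c → a :+ b :+ c := c :+ a :+ b) refl (F 0 M (suc k)) (G M k) (F 0 M (suc (suc k)))

-- The terms of even index count the words with a positive first letter, those of odd index the
-- words that start with 0.
freeCount-formula : ∀ m A → suc m ≤ A →
  ∑[0⋯ suc m ] (λ i → ((A ∸ i / 2) C (suc m ∸ i)) * ((A ∸ (i + 1) / 2) C (i / 2))) ≡ freeCount 1 (suc m) A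
freeCount-formula m (suc A) m<A = trans (∑≡R 0 (suc A) (suc A) (suc m) m<A m<A) (begin
  F 0 (suc A) (suc m) + R 0 (suc A) A m
    ≡⟨ cong (F 0 (suc A) (suc m) +_) (R≡G m) ⟩
  F 0 (suc A) (suc m) + G (suc A) m
    ≡⟨ ℕ.+-comm (F 0 (suc A) (suc m)) _ ⟩
  G (suc A) m + F 0 (suc A) (suc m)
    ≡⟨ cong₂ _+_ (blockedCount-odd m (suc A)) (nonzeroCount-odd (suc m) (suc A)) ⟨
  freeCount 1 (suc m) (suc A) ∎)
  where
  open ≡-Reasoning
  R≡G : ∀ m → R 0 (suc A) A m ≡ G (suc A) m
  R≡G zero    = refl
  R≡G (suc m) = R-pascalˡ 0 A m

-- The terms of even index give the parts 1 and z y² of the factor 1 + y + z y² in the series of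
-- `H`, those of odd index the part y.
nonzeroCount-even-formula : ∀ m A → m ≤ A →
  ∑[0⋯ m ] (λ i → ((A ∸ i / 2) C (m ∸ i)) * ((suc A ∸ (i + 1) / 2) C (i / 2))) ≡ nonzeroCount 0 m (suc A)
nonzeroCount-even-formula m A m≤A = trans (∑≡R 0 A (suc A) m m≤A (ℕ.m≤n⇒m≤1+n m≤A)) (begin
  R 0 A (suc A) m + Rodd 0 A (suc A) m
    ≡⟨ cong (_+ Rodd 0 A (suc A) m) (R-pascalʳ-0 A m) ⟩
  F 0 A m + F₂ A m + Rodd 0 A (suc A) m
    ≡⟨ collect m ⟩
  H (suc A) m
    ≡⟨ nonzeroCount-even m (suc A) ⟨
  nonzeroCount 0 m (suc A) ∎)
  where
  open ≡-Reasoning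
  collect : ∀ m → F 0 A m + F₂ A m + Rodd 0 A (suc A) m ≡ H (suc A) m
  collect zero    = refl
  collect (suc m) = solve 3 (λ a b c → a :+ b :+ c := c :+ a :+ b) refl (F 0 A (suc m)) (F₂ A (suc m)) (F 0 A m)

nonzeroCount-odd-formula : ∀ m A → m ≤ A →
  ∑[0⋯ m / 2 ] (λ i → ((A ∸ i) C (m ∸ 2 * i)) * ((A ∸ i) C i)) ≡ nonzeroCount 1 m A
nonzeroCount-odd-formula m A m≤A = trans (∑≡F 0 A m m≤A) (sym (nonzeroCount-odd m A))

-- Halving and parity

n+n≡n*2 : ∀ n → n + n ≡ n * 2
n+n≡n*2 n = solve 1 (λ n → n :+ n := n :* con 2) refl n

double/2 : ∀ n → (n + n) / 2 ≡ n
double/2 n = trans (cong (_/ 2) (n+n≡n*2 n)) (ℕ.m*n/n≡m n 2)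

suc-double/2 : ∀ n → suc (n + n) / 2 ≡ n
suc-double/2 zero    = refl
suc-double/2 (suc n) = trans (cong (λ k → suc (suc k) / 2) (ℕ.+-suc n n))
  (trans (/2-suc (suc (n + n))) (cong suc (suc-double/2 n)))

suc-double/4 : ∀ n → suc (n + n) / 4 ≡ n / 2
suc-double/4 n = trans (sym (ℕ.m/n/o≡m/[n*o] (suc (n + n)) 2 2)) (cong (_/ 2) (suc-double/2 n))

double-+ : ∀ m n → m + m + (n + n) ≡ (m + n) + (m + n)
double-+ = solve 2 (λ m n → m :+ m :+ (n :+ n) := (m :+ n) :+ (m :+ n)) refl

parity : ∀ n → (∃[ m ] n ≡ m + m) ⊎ (∃[ m ] n ≡ suc (m + m))
parity zero = inj₁ (0 , refl)
parity (suc n) with parity n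
... | inj₁ (m , e) = inj₂ (m , cong suc e)
... | inj₂ (m , e) = inj₁ (suc m , trans (cong suc e) (cong suc (sym (ℕ.+-suc m m))))

2∣double : ∀ n → 2 ∣ n + n
2∣double n = divides n (n+n≡n*2 n)

2∤suc-double : ∀ n → ¬ (2 ∣ suc (n + n))
2∤suc-double n 2∣ with ∣1⇒≡1 (∣m+n∣m⇒∣n (subst (2 ∣_) (ℕ.+-comm 1 (n + n)) 2∣) (2∣double n))
... | ()

odd-even-formula : ∀ m e →
  ∑[0⋯ suc (m + m) / 4 ] (λ i →
    (((suc (m + m) + (e + e) ∸ 1) / 2 ∸ i) C ((suc (m + m) ∸ 1) / 2 ∸ 2 * i))
      * (((suc (m + m) + (e + e) ∸ 1) / 2 ∸ i) C i))
    ≡ nonzeroCount 1 m (m + e)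
odd-even-formula m e
  rewrite suc-double/4 m | double/2 m | double-+ m e | double/2 (m + e) =
  nonzeroCount-odd-formula m (m + e) (ℕ.m≤m+n m e)

odd-odd-formula : ∀ m e →
  ∑[0⋯ suc (m + m) / 2 ] (λ i →
    (((suc (m + m) + suc (e + e) ∸ 1) / 2 ∸ i / 2) C (suc (m + m) / 2 ∸ i))
      * (((suc (m + m) + suc (e + e)) / 2 ∸ (i + 1) / 2) C (i / 2)))
    ≡ nonzeroCount 0 m (suc (m + e))
odd-odd-formula m e
  rewrite suc-double/2 m | ℕ.+-suc (m + m) (e + e) | double-+ m e | suc-double/2 (m + e)
        | /2-suc (m + e + (m + e)) | double/2 (m + e) =
  nonzeroCount-even-formula m (m + e) (ℕ.m≤m+n m e)

even-odd-formula : ∀ m e →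
  ∑[0⋯ (suc m + suc m) / 2 ] (λ i →
    (((suc m + suc m + suc (e + e) ∸ 1) / 2 ∸ i / 2) C ((suc m + suc m) / 2 ∸ i))
      * (((suc m + suc m + suc (e + e)) / 2 ∸ (i + 1) / 2) C (i / 2)))
    ≡ freeCount 1 (suc m) (suc m + e)
even-odd-formula m e = in-terms-of a≡ b≡ (double/2 (suc m))
  where
  doubled : suc m + suc m + suc (e + e) ≡ suc ((suc m + e) + (suc m + e))
  doubled = trans (ℕ.+-suc (suc m + suc m) (e + e)) (cong suc (double-+ (suc m) e))
  a≡ : (suc m + suc m + suc (e + e) ∸ 1) / 2 ≡ suc m + e
  a≡ = trans (cong (λ n → (n ∸ 1) / 2) doubled) (double/2 (suc m + e))
  b≡ : (suc m + suc m + suc (e + e)) / 2 ≡ suc m + e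
  b≡ = trans (cong (_/ 2) doubled) (suc-double/2 (suc m + e))
  in-terms-of : ∀ {a b c} → a ≡ suc m + e → b ≡ suc m + e → c ≡ suc m →
    ∑[0⋯ c ] (λ i → ((a ∸ i / 2) C (c ∸ i)) * ((b ∸ (i + 1) / 2) C (i / 2))) ≡ freeCount 1 (suc m) (suc m + e)
  in-terms-of refl refl refl = freeCount-formula m (suc m + e) (ℕ.m≤m+n (suc m) e)

theorem3p4 :
  ∀ (s d : ℕ) .{{_ : NonZero s}} .{{_ : NonZero d}} → Coprime s d →
  (2 ∣ d →
    HasCount
      (λ p → SelfConjugate p × IsSimultaneousCore (s ∷ s + d ∷ s + 2 * d ∷ s + 3 * d ∷ []) p)
      (∑[0⋯ s / 4 ] (λ i →
        (((s + d ∸ 1) / 2 ∸ i) C ((s ∸ 1) / 2 ∸ 2 * i)) * (((s + d ∸ 1) / 2 ∸ i) C i))))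
  ×
  (¬ (2 ∣ d) →
    HasCount
      (λ p → SelfConjugate p × IsSimultaneousCore (s ∷ s + d ∷ s + 2 * d ∷ s + 3 * d ∷ []) p)
      (∑[0⋯ s / 2 ] (λ i →
        (((s + d ∸ 1) / 2 ∸ i / 2) C (s / 2 ∸ i)) * (((s + d) / 2 ∸ (i + 1) / 2) C (i / 2)))))
theorem3p4 s d coprime with parity s | parity d
... | inj₂ (m , refl) | inj₁ (e , refl) =
  (λ _ → subst (HasCount _) (sym (odd-even-formula m e)) (hasCount-odd-even m e coprime (nonzero-hasCount 1 m (m + e)))) ,
  (λ 2∤d → ⊥-elim (2∤d (2∣double e)))
... | inj₂ (m , refl) | inj₂ (e , refl) =
  (λ 2∣d → ⊥-elim (2∤suc-double e 2∣d)) ,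
  (λ _ → subst (HasCount _) (sym (odd-odd-formula m e)) (hasCount-odd-odd m e coprime (nonzero-hasCount 0 m (suc (m + e)))))
... | inj₁ (suc m , refl) | inj₂ (e , refl) =
  (λ 2∣d → ⊥-elim (2∤suc-double e 2∣d)) ,
  (λ _ → subst (HasCount _) (sym (even-odd-formula m e)) (hasCount-even-odd m e coprime (free-hasCount 1 (suc m) (suc m + e))))
... | inj₁ (m , refl) | inj₁ (e , refl) with coprime (2∣double m , 2∣double e)
...   | ()
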